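{- Every finite semidistributive lattice is semidistrim, and every finite trim lattice is semidistrim.
   Context: All lattices are finite. For a lattice $L$, $\mathcal{J}_L$ (resp. $\mathcal{M}_L$) is the set of join-irreducible (resp. meet-irreducible) elements; for $j\in\mathcal{J}_L$, $j_*$ is the unique element covered by $j$, and for $m\in\mathcal{M}_L$, $m^*$ is the unique element covering $m$. Let $\mathcal{M}_L(j)=\max\{z\in L: j_*=j\wedge z\}$ and $\mathcal{J}_L(m)=\min\{z\in L: m^*=m\vee z\}$. A pairing on $L$ is a bijection $\kappa:\mathcal{J}_L\to\mathcal{M}_L$ with $\kappa(j)\in\mathcal{M}_L(j)$ for all $j$ and $\kappa^{ -1}(m)\in\mathcal{J}_L(m)$ for all $m$; $L$ is uniquely paired if it has exactly one pairing, denoted $\kappa_L$. A prime pair is a pair $(j_0,m_0)$ with $L=[\hat0,m_0]\sqcup[j_0,\hat1]$. A uniquely paired lattice $L$ is compatibly dismantlable if $|L|=1$ or there is a prime pair $(j_0,m_0)$ such that: (i) $[j_0,\hat1]$ is compatibly dismantlable and $\alpha(j)=j_0\vee j$ defines a bijection $\{j\in\mathcal{J}_L: j_0\le\kappa_L(j)\}\to\mathcal{J}_{[j_0,\hat1]}$ with $\kappa_{[j_0,\hat1]}(\alpha(j))=\kappa_L(j)$; (ii) $[\hat0,m_0]$ is compatibly dismantlable and $\beta(m)=m_0\wedge m$ defines a bijection $\{m\in\mathcal{M}_L:\kappa_L^{ -1}(m)\le m_0\}\to\mathcal{M}_{[\hat0,m_0]}$ with $\kappa_{[\hat0,m_0]}^{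 -1}(\beta(m))=\kappa_L^{ -1}(m)$. The Galois graph $G_L$ of a uniquely paired $L$ is the directed graph on $\mathcal{J}_L$ with an edge $j\to j'$ iff $j\ne j'$ and $j\not\le\kappa_L(j')$. For $x\in L$ let $J_L(x)=\{j\in\mathcal{J}_L:j\le x\}$ and $M_L(x)=\{j\in\mathcal{J}_L:\kappa_L(j)\ge x\}$. For a compatibly dismantlable $L$, for every cover $x\lessdot y$ the set $M_L(x)\cap J_L(y)$ has exactly one element $j_{xy}$; set $\mathcal{D}_L(x)=\{j_{yx}:y\lessdot x\}$ and $\mathcal{U}_L(x)=\{j_{xy}:x\lessdot y\}$. $L$ is semidistrim if it is compatibly dismantlable and $\mathcal{D}_L(x)$, $\mathcal{U}_L(x)$ are independent sets (no two elements adjacent) of $G_L$ for all $x\in L$. A lattice is semidistributive if it is join-semidistributive ($x\vee y=x\vee z\Rightarrow x\vee(y\wedge z)=x\vee y$) and meet-semidistributive ($x\wedge y=x\wedge z\Rightarrow x\wedge(y\vee z)=x\wedge y$). A lattice is extremal if it has a maximum-length chain $\hat0=x_0\lessdot\cdots\lessdot x_n=\hat1$ with $|\mathcal{J}_L|=|\mathcal{M}_L|=n$; $x$ is left modular if $(y\vee x)\wedge z=y\vee(x\wedge z)$ for all $y\le z$; $L$ is left modular if it has a maximal chain of left modular elements; $L$ is trim if it is extremal and left modular. -}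

module Defs where

open import Data.Nat using (ℕ) renaming (_≤_ to _≤ℕ_)
open import Data.Fin using (Fin; inject₁; fromℕ) renaming (zero to fzero; suc to fsuc)
open import Data.Product using (∃; _×_)
open import Data.Sum using (_⊎_)
open import Data.Empty using (⊥)
open import Data.List using (List; length)
open import Data.List.Membership.Propositional using (_∈_)
open import Data.List.Relation.Unary.Unique.Propositional using (Unique)
open import Relation.Nullary using (¬_)
open import Relation.Binary.PropositionalEquality using (_≡_; _≢_)
open import Relation.Binary.Lattice.Structures using (IsBoundedLattice)

-- A finite lattice: carrier Fin size (equality is ≡), a partial order,
-- join, meet, top and bottom (every finite nonempty lattice is bounded).
record FinLattice : Set₁ where
  field
    size : ℕ
    _≤_ : Fin size → Fin size → Set
    _∨_ _∧_ : Fin size → Fin size → Fin size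
    top bot : Fin size
    isBoundedLattice : IsBoundedLattice _≡_ _≤_ _∨_ _∧_ top bot

module Notions (L : FinLattice) where
  open FinLattice L

  Elt : Set
  Elt = Fin size

  _<_ : Elt → Elt → Set
  x < y = x ≤ y × x ≢ y

  _⋖_ : Elt → Elt → Set
  x ⋖ y = x < y × (∀ z → x ≤ z → z ≤ y → z ≡ x ⊎ z ≡ y)

  -- All notions below are relative to an interval [a,b] of L (itself a lattice
  -- with the same join, meet and cover relation). L itself is [bot,top].
  InI : Elt → Elt → Elt → Set
  InI a b x = a ≤ x × x ≤ b

  JIw : Elt → Elt → Elt → Elt → Set
  JIw a b j s = InI a b j × InI a b s × s ⋖ j × (∀ z → InI a b z → z ⋖ j → z ≡ s)

  MIw : Elt → Elt → Elt → Elt → Set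
  MIw a b m t = InI a b m × InI a b t × m ⋖ t × (∀ z → InI a b z → m ⋖ z → z ≡ t)

  JI : Elt → Elt → Elt → Set
  JI a b j = ∃ λ s → JIw a b j s

  MI : Elt → Elt → Elt → Set
  MI a b m = ∃ λ t → MIw a b m t

  InMset : Elt → Elt → Elt → Elt → Elt → Set
  InMset a b j s z = InI a b z × s ≡ j ∧ z
                     × (∀ w → InI a b w → s ≡ j ∧ w → z ≤ w → w ≡ z)

  InJset : Elt → Elt → Elt → Elt → Elt → Set
  InJset a b m t z = InI a b z × t ≡ m ∨ z
                     × (∀ w → InI a b w → t ≡ m ∨ w → w ≤ z → w ≡ z)

  -- κ (only its values on join-irreducibles matter) is a pairing of [a,b]
  record Pairing (a b : Elt) (κ : Elt → Elt) : Set where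
    field
      toMI : ∀ j → JI a b j → MI a b (κ j)
      injective : ∀ j j' → JI a b j → JI a b j' → κ j ≡ κ j' → j ≡ j'
      surjective : ∀ m → MI a b m → ∃ λ j → JI a b j × κ j ≡ m
      κ∈𝓜 : ∀ j s → JIw a b j s → InMset a b j s (κ j)
      κ⁻¹∈𝓙 : ∀ j → JI a b j → ∀ t → MIw a b (κ j) t → InJset a b (κ j) t j

  UniquePairing : Elt → Elt → (Elt → Elt) → Set
  UniquePairing a b κ = Pairing a b κ
    × (∀ κ' → Pairing a b κ' → ∀ j → JI a b j → κ' j ≡ κ j)

  PrimePair : Elt → Elt → Elt → Elt → Set
  PrimePair a b j0 m0 = InI a b j0 × InI a b m0
    × (∀ x → InI a b x → x ≤ m0 ⊎ j0 ≤ x)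
    × (∀ x → InI a b x → x ≤ m0 → j0 ≤ x → ⊥)

  record CondI (a b : Elt) (κ : Elt → Elt) (j0 : Elt) (κ₁ : Elt → Elt) : Set where
    field
      maps : ∀ j → JI a b j → j0 ≤ κ j → JI j0 b (j0 ∨ j) × κ₁ (j0 ∨ j) ≡ κ j
      inj : ∀ j j' → JI a b j → JI a b j' → j0 ≤ κ j → j0 ≤ κ j'
            → j0 ∨ j ≡ j0 ∨ j' → j ≡ j'
      surj : ∀ j' → JI j0 b j' → ∃ λ j → JI a b j × j0 ≤ κ j × j0 ∨ j ≡ j'

  -- condition (ii): β(m) = m0 ∧ m is a bijection
  -- {m ∈ 𝓜_[a,b] : κ⁻¹ m ≤ m0} → 𝓜_[a,m0] with κ₂⁻¹(β m) = κ⁻¹ m.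
  -- Elements m of 𝓜_[a,b] are written m = κ j with j ∈ 𝓙_[a,b].
  record CondII (a b : Elt) (κ : Elt → Elt) (m0 : Elt) (κ₂ : Elt → Elt) : Set where
    field
      maps : ∀ j → JI a b j → j ≤ m0
             → MI a m0 (m0 ∧ κ j) × JI a m0 j × κ₂ j ≡ m0 ∧ κ j
      inj : ∀ j j' → JI a b j → JI a b j' → j ≤ m0 → j' ≤ m0
            → m0 ∧ κ j ≡ m0 ∧ κ j' → κ j ≡ κ j'
      surj : ∀ m' → MI a m0 m' → ∃ λ j → JI a b j × j ≤ m0 × m0 ∧ κ j ≡ m'

  data CompDism : Elt → Elt → (Elt → Elt) → Set where
    trivial : ∀ {a b κ} → a ≡ b → UniquePairing a b κ → CompDism a b κ
    dismantle : ∀ {a b κ} → UniquePairing a b κ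
      → (j0 m0 : Elt) → PrimePair a b j0 m0
      → (κ₁ κ₂ : Elt → Elt)
      → CompDism j0 b κ₁ → CompDism a m0 κ₂
      → CondI a b κ j0 κ₁ → CondII a b κ m0 κ₂
      → CompDism a b κ

  Edge : (Elt → Elt) → Elt → Elt → Set
  Edge κ j j' = j ≢ j' × ¬ (j ≤ κ j')

  -- j ∈ M_L(x) ∩ J_L(y), i.e. j = j_{xy} (for a cover x ⋖ y)
  Label : (Elt → Elt) → Elt → Elt → Elt → Set
  Label κ x y j = JI bot top j × x ≤ κ j × j ≤ y

  DownIndep : (Elt → Elt) → Set
  DownIndep κ = ∀ x y y' j j' → y ⋖ x → y' ⋖ x
    → Label κ y x j → Label κ y' x j' → ¬ Edge κ j j'

  UpIndep : (Elt → Elt) → Set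
  UpIndep κ = ∀ x y y' j j' → x ⋖ y → x ⋖ y'
    → Label κ x y j → Label κ x y' j' → ¬ Edge κ j j'

  Semidistrim : Set
  Semidistrim = ∃ λ κ → CompDism bot top κ × DownIndep κ × UpIndep κ

  JoinSemidistributive : Set
  JoinSemidistributive = ∀ x y z → x ∨ y ≡ x ∨ z → x ∨ (y ∧ z) ≡ x ∨ y

  MeetSemidistributive : Set
  MeetSemidistributive = ∀ x y z → x ∧ y ≡ x ∧ z → x ∧ (y ∨ z) ≡ x ∧ y

  Semidistributive : Set
  Semidistributive = JoinSemidistributive × MeetSemidistributive

  HasCard : (Elt → Set) → ℕ → Set
  HasCard P n = ∃ λ (xs : List Elt) → Unique xs
    × (∀ x → x ∈ xs → P x) × (∀ x → P x → x ∈ xs) × length xs ≡ n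

  MaximalChain : (n : ℕ) → (Fin (ℕ.suc n) → Elt) → Set
  MaximalChain n c = c fzero ≡ bot × c (fromℕ n) ≡ top
    × (∀ (i : Fin n) → c (inject₁ i) ⋖ c (fsuc i))

  Extremal : Set
  Extremal = ∃ λ n → ∃ λ (c : Fin (ℕ.suc n) → Elt) → MaximalChain n c
    × (∀ k (d : Fin (ℕ.suc k) → Elt) → (∀ (i : Fin k) → d (inject₁ i) < d (fsuc i)) → k ≤ℕ n)
    × HasCard (JI bot top) n × HasCard (MI bot top) n

  LeftModularElt : Elt → Set
  LeftModularElt x = ∀ y z → y ≤ z → (y ∨ x) ∧ z ≡ y ∨ (x ∧ z)

  LeftModular : Set
  LeftModular = ∃ λ n → ∃ λ (c : Fin (ℕ.suc n) → Elt) → MaximalChain n c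
    × (∀ i → LeftModularElt (c i))

  Trim : Set
  Trim = Extremal × LeftModular

{-# OPTIONS --safe #-}

-- Pair each join-irreducible jj i with mm i = κ (jj i). If every cover y ⋖ z of an interval has a
-- label i with jj i ≤ z and y ≤ mm i, this is a pairing, and for a lower end e the elements e ∨ jj i
-- with e ≤ mm i, still paired with mm i, form such a labelling of [e , b]: a minimal p ≤ e ∨ jj i
-- not below mm i is join-irreducible, so p = e ∨ jj k for some k, and jj i ≤ jj k follows either from
-- semidistributivity or from the absence of 2-cycles in the Galois graph, whence p = e ∨ jj i. The
-- dual argument handles [a , f], and induction on the number of labels gives compatible
-- dismantlability.
-- A semidistributive lattice is labelled by the maximal mm j ≥ j_* with j ≰ mm j. In a trim lattice
-- the chain of left modular elements has maximal length, so each of its steps contributes exactly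
-- one join-irreducible and one meet-irreducible, and left modularity makes the two labels of a
-- cover agree.

module Submission where

open import Defs
open import Data.Empty using (⊥; ⊥-elim)
open import Data.Fin using (Fin; fromℕ; inject₁; toℕ) renaming (zero to fzero; suc to fsuc)
open import Data.Fin.Induction using (po-wellFounded)
import Data.Fin.Properties as F
open import Data.Fin.Properties using (injective⇒≤; toℕ-inject₁; toℕ-injective)
open import Data.List using (List; allFin; filter; length; lookup)
open import Data.List.Membership.Propositional using (_∈_; find; lose)
open import Data.List.Membership.Propositional.Properties using (∈-allFin; ∈-filter⁺; ∈-filter⁻)
open import Data.List.Properties using (filter-notAll)
open import Data.List.Relation.Unary.Any using (any?; index)
open import Data.List.Relation.Unary.Any.Properties using (lookup-index)
open import Data.Nat using (ℕ; z≤n; s≤s) renaming (_<_ to _<ℕ_; _≤_ to _≤ℕ_)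
import Data.Nat.Induction as ℕI
import Data.Nat.Properties as ℕP
open import Data.Product using (∃; ∃₂; _×_; _,_; proj₁; proj₂)
import Data.Sum as Sum
open import Data.Sum using (_⊎_; inj₁; inj₂)
open import Function using (_∘_; id)
open import Induction.WellFounded using (Acc; acc)
open import Relation.Binary using (tri<; tri≈; tri>)
open import Relation.Binary.Lattice.Structures using (IsBoundedLattice)
open import Relation.Binary.PropositionalEquality
  using (_≡_; _≢_; refl; sym; trans; cong; subst; isEquivalence)
open import Relation.Nullary using (¬_; Dec; yes; no)
open import Relation.Nullary.Decidable
  using (map′; decidable-stable; ¬?; _×-dec_; _→-dec_; _⊎-dec_)

-- Order duality and irreducible elements

dual : FinLattice → FinLattice
dual L = record
  { size = size
  ; _≤_ = λ x y → y ≤ x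
  ; _∨_ = _∧_
  ; _∧_ = _∨_
  ; top = bot
  ; bot = top
  ; isBoundedLattice = record
    { isLattice = record
      { isPartialOrder = record
        { isPreorder = record
          { isEquivalence = isEquivalence
          ; reflexive = λ { refl → B.refl }
          ; trans = λ p q → B.trans q p
          }
        ; antisym = λ p q → B.antisym q p
        }
      ; supremum = B.infimum
      ; infimum = B.supremum
      }
    ; maximum = B.minimum
    ; minimum = B.maximum
    }
  }
  where
  open FinLattice L
  module B = IsBoundedLattice isBoundedLattice

module Order (L : FinLattice) where
  open FinLattice L public
  open Notions L public
  open IsBoundedLattice isBoundedLattice public
    using (antisym; x≤x∨y; y≤x∨y; ∨-least; x∧y≤x; x∧y≤y; ∧-greatest; maximum; minimum; isPartialOrder)
    renaming (refl to ≤-refl; trans to ≤-trans; reflexive to ≤-reflexive)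

  infix 4 _≤?_
  abstract
    -- The order comes without a decision procedure; equality on `Fin size` supplies one. The
    -- searches and the proofs by contradiction about `≤` rest on it.
    _≤?_ : (x y : Elt) → Dec (x ≤ y)
    x ≤? y = map′ (λ e → subst (_≤ y) e (x∧y≤y x y))
                  (λ x≤y → antisym (x∧y≤x x y) (∧-greatest ≤-refl x≤y))
                  ((x ∧ y) F.≟ x)

  ∨-monoʳ : ∀ x {y z} → y ≤ z → (x ∨ y) ≤ (x ∨ z)
  ∨-monoʳ x y≤z = ∨-least (x≤x∨y x _) (≤-trans y≤z (y≤x∨y x _))

  x≤y⇒x∧y≡x : ∀ {x y} → x ≤ y → x ∧ y ≡ x
  x≤y⇒x∧y≡x {x} {y} x≤y = antisym (x∧y≤x x y) (∧-greatest ≤-refl x≤y)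

  x∧y≡x⇒x≤y : ∀ {x y} → x ∧ y ≡ x → x ≤ y
  x∧y≡x⇒x≤y {x} {y} e = subst (_≤ y) e (x∧y≤y x y)

  ∧-comm : ∀ x y → x ∧ y ≡ y ∧ x
  ∧-comm x y = antisym (∧-greatest (x∧y≤y x y) (x∧y≤x x y)) (∧-greatest (x∧y≤y y x) (x∧y≤x y x))

  ⋖⇒≤ : ∀ {x y} → x ⋖ y → x ≤ y
  ⋖⇒≤ ((x≤y , _) , _) = x≤y

  ⋖⇒≰ : ∀ {x y} → x ⋖ y → ¬ y ≤ x
  ⋖⇒≰ ((x≤y , x≢y) , _) y≤x = x≢y (antisym x≤y y≤x)

  ⋖-join : ∀ {x y w} → x ⋖ y → w ≤ y → ¬ w ≤ x → y ≤ (x ∨ w)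
  ⋖-join {x} {y} {w} x⋖y w≤y w≰x with proj₂ x⋖y (x ∨ w) (x≤x∨y x w) (∨-least (⋖⇒≤ x⋖y) w≤y)
  ... | inj₁ e = ⊥-elim (w≰x (subst (w ≤_) e (y≤x∨y x w)))
  ... | inj₂ e = ≤-reflexive (sym e)

  ⋖-join≡ : ∀ {x y w} → x ⋖ y → w ≤ y → ¬ w ≤ x → x ∨ w ≡ y
  ⋖-join≡ x⋖y w≤y w≰x = antisym (∨-least (⋖⇒≤ x⋖y) w≤y) (⋖-join x⋖y w≤y w≰x)

  ⋖-antichain : ∀ {x y z} → y ⋖ x → z ⋖ x → z ≤ y → y ≡ z
  ⋖-antichain {x} {y} y⋖x z⋖x z≤y with proj₂ z⋖x y z≤y (⋖⇒≤ y⋖x)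
  ... | inj₁ e = e
  ... | inj₂ e = ⊥-elim (proj₂ (proj₁ y⋖x) e)

  ⋖-meet : ∀ {x y w} → x ⋖ y → x ≤ w → ¬ y ≤ w → (w ∧ y) ≤ x
  ⋖-meet {x} {y} {w} x⋖y x≤w y≰w with proj₂ x⋖y (w ∧ y) (∧-greatest x≤w (⋖⇒≤ x⋖y)) (x∧y≤y w y)
  ... | inj₁ e = ≤-reflexive e
  ... | inj₂ e = ⊥-elim (y≰w (subst (_≤ w) e (x∧y≤x w y)))

  _<?_ : (x y : Elt) → Dec (x < y)
  x <? y = (x ≤? y) ×-dec ¬? (x F.≟ y)

  _⋖?_ : (x y : Elt) → Dec (x ⋖ y)
  x ⋖? y = (x <? y) ×-dec
    F.all? (λ z → (x ≤? z) →-dec ((z ≤? y) →-dec ((z F.≟ x) ⊎-dec (z F.≟ y))))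

  InI? : ∀ a b x → Dec (InI a b x)
  InI? a b x = (a ≤? x) ×-dec (x ≤? b)

  abstract
    JI? : ∀ a b j → Dec (JI a b j)
    JI? a b j = F.any? (λ s → InI? a b j ×-dec InI? a b s ×-dec (s ⋖? j) ×-dec
      F.all? (λ z → InI? a b z →-dec ((z ⋖? j) →-dec (z F.≟ s))))

  abstract
    minimal : {P : Elt → Set} → (∀ x → Dec (P x)) → ∀ u → P u
      → ∃ λ p → p ≤ u × P p × (∀ w → P w → w ≤ p → w ≡ p)
    minimal {P} P? u Pu = go u Pu (po-wellFounded isPartialOrder u)
      where
      go : ∀ u → P u → Acc _<_ u → ∃ λ p → p ≤ u × P p × (∀ w → P w → w ≤ p → w ≡ p)
      go u Pu (acc rs) with F.any? (λ w → P? w ×-dec (w <? u))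
      ... | yes (w , Pw , w<u) with go w Pw (rs w<u)
      ...   | p , p≤w , rest = p , ≤-trans p≤w (proj₁ w<u) , rest
      go u Pu (acc rs) | no none = u , ≤-refl , Pu , λ w Pw w≤u →
        decidable-stable (w F.≟ u) (λ w≢u → none (w , Pw , w≤u , w≢u))

  abstract
    upper-cover : ∀ {x y} → x < y → ∃ λ z → x ⋖ z × z ≤ y
    upper-cover {x} {y} x<y with minimal (x <?_) y x<y
    ... | z , z≤y , x<z , min = z , (x<z , between) , z≤y
      where
      between : ∀ w → x ≤ w → w ≤ z → w ≡ x ⊎ w ≡ z
      between w x≤w w≤z with x F.≟ w
      ... | yes x≡w = inj₁ (sym x≡w)
      ... | no x≢w = inj₂ (min w (x≤w , x≢w) w≤z)

  meet-irreducible-cover : ∀ {a b m t w} → MIw a b m t → m ≤ w → w ≤ b → w ≢ m → t ≤ w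
  meet-irreducible-cover ((a≤m , _) , _ , _ , unique) m≤w w≤b w≢m
    with upper-cover (m≤w , w≢m ∘ sym)
  ... | z , m⋖z , z≤w =
    subst (_≤ _) (unique z (≤-trans a≤m (⋖⇒≤ m⋖z) , ≤-trans z≤w w≤b) m⋖z) z≤w

module Conversions (L : FinLattice) where
  private
    module O = Order L
    module D = Order (dual L)

  ⋖-dual : ∀ {x y} → x O.⋖ y → y D.⋖ x
  ⋖-dual ((x≤y , x≢y) , between) = (x≤y , x≢y ∘ sym) , λ z z≤y x≤z → Sum.swap (between z x≤z z≤y)

  ⋖-undual : ∀ {x y} → y D.⋖ x → x O.⋖ y
  ⋖-undual ((x≤y , x≢y) , between) = (x≤y , x≢y ∘ sym) , λ z z≤y x≤z → Sum.swap (between z x≤z z≤y)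

  MIw-dual : ∀ {a b m t} → O.MIw a b m t → D.JIw b a m t
  MIw-dual ((p , q) , (p′ , q′) , m⋖t , unique) =
    (q , p) , (q′ , p′) , ⋖-dual m⋖t , λ { z (r , s) c → unique z (s , r) (⋖-undual c) }

  MIw-undual : ∀ {a b m t} → D.JIw b a m t → O.MIw a b m t
  MIw-undual ((p , q) , (p′ , q′) , m⋖t , unique) =
    (q , p) , (q′ , p′) , ⋖-undual m⋖t , λ { z (r , s) c → unique z (s , r) (⋖-dual c) }

  JIw-dual : ∀ {a b j s} → O.JIw a b j s → D.MIw b a j s
  JIw-dual ((p , q) , (p′ , q′) , s⋖j , unique) =
    (q , p) , (q′ , p′) , ⋖-dual s⋖j , λ { z (r , s) c → unique z (s , r) (⋖-undual c) }

  JIw-undual : ∀ {a b j s} → D.MIw b a j s → O.JIw a b j s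
  JIw-undual ((p , q) , (p′ , q′) , s⋖j , unique) =
    (q , p) , (q′ , p′) , ⋖-undual s⋖j , λ { z (r , s) c → unique z (s , r) (⋖-dual c) }

  JI-dual : ∀ {a b j} → O.JI a b j → D.MI b a j
  JI-dual (s , p) = s , JIw-dual p

  JI-undual : ∀ {a b j} → D.MI b a j → O.JI a b j
  JI-undual (s , p) = s , JIw-undual p

  MI-dual : ∀ {a b m} → O.MI a b m → D.JI b a m
  MI-dual (t , p) = t , MIw-dual p

  MI-undual : ∀ {a b m} → D.JI b a m → O.MI a b m
  MI-undual (t , p) = t , MIw-undual p

module Irreducibles (L : FinLattice) where
  open Order L public
  open Conversions L public
  private
    module D = Order (dual L)

  lower-cover : ∀ {x y} → x < y → ∃ λ z → x ≤ z × z ⋖ y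
  lower-cover (x≤y , x≢y) with D.upper-cover (x≤y , x≢y ∘ sym)
  ... | z , z⋖y , x≤z = z , x≤z , ⋖-undual z⋖y

  join-irreducible-cover : ∀ {a b j s w} → JIw a b j s → w ≤ j → a ≤ w → w ≢ j → w ≤ s
  join-irreducible-cover jw = D.meet-irreducible-cover (JIw-dual jw)

  abstract
    -- Take `p` minimal among the elements of `[a , u]` that are not below `v`. Everything else in
    -- `[a , p]` is below `v`, and so is any join of two lower covers of `p`; two different ones
    -- would join to `p` itself.
    minimal-JI : ∀ {a b u v} → a ≤ u → u ≤ b → a ≤ v → ¬ u ≤ v
      → ∃₂ λ p s → JIw a b p s × p ≤ u × ¬ p ≤ v × s ≤ v
    minimal-JI {a} {b} {u} {v} a≤u u≤b a≤v u≰v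
      with minimal (λ w → (a ≤? w) ×-dec ¬? (w ≤? v)) u (a≤u , u≰v)
    ... | p , p≤u , (a≤p , p≰v) , min = result
      where
      below : ∀ w → a ≤ w → w ≤ p → w ≢ p → w ≤ v
      below w a≤w w≤p w≢p =
        decidable-stable (w ≤? v) (λ w≰v → w≢p (min w (a≤w , w≰v) w≤p))

      result : ∃₂ λ p s → JIw a b p s × p ≤ u × ¬ p ≤ v × s ≤ v
      result with lower-cover {a} {p} (a≤p , λ { refl → p≰v a≤v })
      ... | s , a≤s , s⋖p = p , s ,
        ((a≤p , p≤b) , (a≤s , ≤-trans (⋖⇒≤ s⋖p) p≤b) , s⋖p , unique) , p≤u , p≰v , s≤v
        where
        p≤b : p ≤ b
        p≤b = ≤-trans p≤u u≤b

        s≤v : s ≤ v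
        s≤v = below s a≤s (⋖⇒≤ s⋖p) (proj₂ (proj₁ s⋖p))

        unique : ∀ z → InI a b z → z ⋖ p → z ≡ s
        unique z (a≤z , _) z⋖p
          with proj₂ s⋖p (s ∨ z) (x≤x∨y s z) (∨-least (⋖⇒≤ s⋖p) (⋖⇒≤ z⋖p))
        ... | inj₂ e = ⊥-elim (p≰v (subst (_≤ v) e (∨-least s≤v
                         (below z a≤z (⋖⇒≤ z⋖p) (proj₂ (proj₁ z⋖p))))))
        ... | inj₁ e with proj₂ z⋖p s (subst (z ≤_) e (y≤x∨y s z)) (⋖⇒≤ s⋖p)
        ...   | inj₁ s≡z = sym s≡z
        ...   | inj₂ s≡p = ⊥-elim (proj₂ (proj₁ s⋖p) s≡p)

module Lattice (L : FinLattice) where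
  open Irreducibles L public
  private
    module D = Irreducibles (dual L)

  abstract
    maximal-MI : ∀ {a b u v} → a ≤ u → u ≤ b → v ≤ b → ¬ v ≤ u
      → ∃₂ λ q t → MIw a b q t × u ≤ q × ¬ v ≤ q × v ≤ t
    maximal-MI a≤u u≤b v≤b v≰u with D.minimal-JI u≤b a≤u v≤b v≰u
    ... | q , t , qw , rest = q , t , MIw-undual qw , rest

-- Labellings and the pairings they define

record Labelling (L : FinLattice) (a b : Notions.Elt L) {I : Set} (xs : List I)
                 (jj mm : I → Notions.Elt L) : Set where
  open FinLattice L
  open Notions L
  field
    jj-JI : ∀ {i} → i ∈ xs → JI a b (jj i)
    mm-MI : ∀ {i} → i ∈ xs → MI a b (mm i)
    JI-jj : ∀ {j} → JI a b j → ∃ λ i → i ∈ xs × jj i ≡ j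
    MI-mm : ∀ {m} → MI a b m → ∃ λ i → i ∈ xs × mm i ≡ m
    -- Equal fibres of `jj` and `mm`, rather than injectivity, make sending `jj i` to `mm i` a
    -- well-defined bijection and allow repeated indices. The index type stays fixed while `xs` is
    -- filtered on passing to an interval.
    jj⇒mm : ∀ {i k} → i ∈ xs → k ∈ xs → jj i ≡ jj k → mm i ≡ mm k
    mm⇒jj : ∀ {i k} → i ∈ xs → k ∈ xs → mm i ≡ mm k → jj i ≡ jj k
    jj≰mm : ∀ {i} → i ∈ xs → ¬ jj i ≤ mm i
    label : ∀ {y z} → a ≤ y → z ≤ b → y ⋖ z → ∃ λ i → i ∈ xs × jj i ≤ z × y ≤ mm i

module _ {L : FinLattice} {I : Set} {xs : List I} {jj mm : I → Notions.Elt L} where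
  dual-labelling : ∀ {a b} → Labelling L a b xs jj mm → Labelling (dual L) b a xs mm jj
  dual-labelling d = record
    { jj-JI = MI-dual ∘ mm-MI
    ; mm-MI = JI-dual ∘ jj-JI
    ; JI-jj = MI-mm ∘ MI-undual
    ; MI-mm = JI-jj ∘ JI-undual
    ; jj⇒mm = mm⇒jj
    ; mm⇒jj = jj⇒mm
    ; jj≰mm = jj≰mm
    ; label = λ y≤b a≤z z⋖y → let (i , i∈xs , jj≤ , ≤mm) = label a≤z y≤b (⋖-undual z⋖y)
                               in i , i∈xs , ≤mm , jj≤
    }
    where
    open Labelling d
    open Conversions L

module LabellingCovers {L : FinLattice} {a b : Notions.Elt L} {I : Set} {xs : List I}
                       {jj mm : I → Notions.Elt L} (d : Labelling L a b xs jj mm) where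
  open Labelling d public
  open Lattice L public

  -- Let `k` label the cover of `mm i`. If `mm k` differs from `mm i`, it lies above `t` and so
  -- above `jj k`, which is impossible; equal values of `mm` then give `jj k ≡ jj i`.
  jj≤upper-cover : ∀ {i t} → i ∈ xs → MIw a b (mm i) t → jj i ≤ t
  jj≤upper-cover {i} {t} i∈xs mw@((a≤m , m≤b) , (_ , t≤b) , m⋖t , _) with label a≤m t≤b m⋖t
  ... | k , k∈xs , jk≤t , mi≤mk with mm k F.≟ mm i
  ...   | yes e = subst (_≤ t) (mm⇒jj k∈xs i∈xs e) jk≤t
  ...   | no mk≢mi = ⊥-elim (jj≰mm k∈xs (≤-trans jk≤t
            (meet-irreducible-cover mw mi≤mk (proj₂ (proj₁ (proj₂ (mm-MI k∈xs)))) mk≢mi)))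

module LabellingPairing {L : FinLattice} {a b : Notions.Elt L} {I : Set} {xs : List I}
                        {jj mm : I → Notions.Elt L} (d : Labelling L a b xs jj mm) where
  open LabellingCovers d public
  private
    module D = LabellingCovers (dual-labelling d)

  lower-cover≤mm : ∀ {i s} → i ∈ xs → JIw a b (jj i) s → s ≤ mm i
  lower-cover≤mm i∈xs jw = D.jj≤upper-cover i∈xs (JIw-dual jw)

  mm∈𝓜 : ∀ {i s} → i ∈ xs → JIw a b (jj i) s → InMset a b (jj i) s (mm i)
  mm∈𝓜 {i} {s} i∈xs jw@((a≤j , _) , _ , s⋖j , _) with mm-MI i∈xs
  ... | t , mw@(m∈I , _) = m∈I
      , antisym (∧-greatest (⋖⇒≤ s⋖j) (lower-cover≤mm i∈xs jw))
                (join-irreducible-cover jw (x∧y≤x _ _) (∧-greatest a≤j (proj₁ m∈I))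
                  (jj≰mm i∈xs ∘ x∧y≡x⇒x≤y))
      , λ w (_ , w≤b) s≡j∧w m≤w → decidable-stable (w F.≟ mm i) λ w≢m →
          proj₂ (proj₁ s⋖j) (trans s≡j∧w (x≤y⇒x∧y≡x
            (≤-trans (jj≤upper-cover i∈xs mw) (meet-irreducible-cover mw m≤w w≤b w≢m))))

  lower≤mm : ∀ {i w} → i ∈ xs → a ≤ w → w ≤ jj i → w ≢ jj i → w ≤ mm i
  lower≤mm i∈xs a≤w w≤j w≢j with jj-JI i∈xs
  ... | s , jw = ≤-trans (join-irreducible-cover jw w≤j a≤w w≢j) (lower-cover≤mm i∈xs jw)

module PairingMap (L : FinLattice) {I : Set} (xs : List I) (jj mm : I → Notions.Elt L) where
  open Notions L

  index? : ∀ p → Dec (∃ λ i → i ∈ xs × jj i ≡ p)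
  index? p = map′ find (λ { (i , i∈xs , e) → lose i∈xs e }) (any? (λ i → jj i F.≟ p) xs)

  κ : Elt → Elt
  κ p with index? p
  ... | yes (i , _) = mm i
  -- Default value: a pairing is constrained only at join-irreducibles, and a labelling lists all of
  -- them.
  ... | no _ = p

  κ-jj : (∀ {i k} → i ∈ xs → k ∈ xs → jj i ≡ jj k → mm i ≡ mm k)
    → ∀ {i} → i ∈ xs → κ (jj i) ≡ mm i
  κ-jj jj⇒mm {i} i∈xs with index? (jj i)
  ... | yes (k , k∈xs , e) = jj⇒mm k∈xs i∈xs e
  ... | no none = ⊥-elim (none (i , i∈xs , refl))

-- An edge of the Galois graph from `jj i` to `jj k` means that `jj i` is not below `mm k`, so
-- `rank-<` makes the rank drop strictly along every edge: a numerical form of acyclicity.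
record Ordered (L : FinLattice) {I : Set} (xs : List I) (jj mm : I → Notions.Elt L) : Set where
  open FinLattice L
  field
    rank : I → ℕ
    rank-injective : ∀ {i k} → rank i ≡ rank k → i ≡ k
    rank-< : ∀ {i k} → i ∈ xs → k ∈ xs → rank i <ℕ rank k → jj i ≤ mm k

Kind : (L : FinLattice) {I : Set} (xs : List I) (jj mm : I → Notions.Elt L) → Set
Kind L xs jj mm = Notions.Semidistributive L ⊎ Ordered L xs jj mm

module Uniqueness {L : FinLattice} {a b : Notions.Elt L} {I : Set} {xs : List I}
                  {jj mm : I → Notions.Elt L} (d : Labelling L a b xs jj mm) where
  open LabellingPairing d public
  open PairingMap L xs jj mm public using (κ)
  private
    module D = LabellingPairing (dual-labelling d)

  κ-jj : ∀ {i} → i ∈ xs → κ (jj i) ≡ mm i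
  κ-jj = PairingMap.κ-jj L xs jj mm jj⇒mm

  jj∈𝓙 : ∀ {i t} → i ∈ xs → MIw a b (mm i) t → InJset a b (mm i) t (jj i)
  jj∈𝓙 i∈xs mw with D.mm∈𝓜 i∈xs (MIw-dual mw)
  ... | (p , q) , e , min = (q , p) , e , λ { w (r , s) → min w (s , r) }

  pairing : Pairing a b κ
  pairing = record
    { toMI = toMI
    ; injective = injective
    ; surjective = surjective
    ; κ∈𝓜 = κ∈𝓜
    ; κ⁻¹∈𝓙 = κ⁻¹∈𝓙
    }
    where
    toMI : ∀ j → JI a b j → MI a b (κ j)
    toMI j ji with JI-jj ji
    ... | i , i∈xs , refl = subst (MI a b) (sym (κ-jj i∈xs)) (mm-MI i∈xs)

    injective : ∀ j j' → JI a b j → JI a b j' → κ j ≡ κ j' → j ≡ j'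
    injective j j' ji ji' e with JI-jj ji | JI-jj ji'
    ... | i , i∈xs , refl | k , k∈xs , refl =
      mm⇒jj i∈xs k∈xs (trans (sym (κ-jj i∈xs)) (trans e (κ-jj k∈xs)))

    surjective : ∀ m → MI a b m → ∃ λ j → JI a b j × κ j ≡ m
    surjective m mi with MI-mm mi
    ... | i , i∈xs , refl = jj i , jj-JI i∈xs , κ-jj i∈xs

    κ∈𝓜 : ∀ j s → JIw a b j s → InMset a b j s (κ j)
    κ∈𝓜 j s jw with JI-jj (s , jw)
    ... | i , i∈xs , refl = subst (InMset a b j s) (sym (κ-jj i∈xs)) (mm∈𝓜 i∈xs jw)

    κ⁻¹∈𝓙 : ∀ j → JI a b j → ∀ t → MIw a b (κ j) t → InJset a b (κ j) t j
    κ⁻¹∈𝓙 j ji t mw with JI-jj ji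
    ... | i , i∈xs , refl = subst (λ m → InJset a b m t (jj i)) (sym (κ-jj i∈xs))
            (jj∈𝓙 i∈xs (subst (λ m → MIw a b m t) (κ-jj i∈xs) mw))

  -- Both `w` and `mm i` meet `jj i` in `s`, so their join does too, and maximality of `mm i`
  -- absorbs `w`. Thus `mm i` is the greatest candidate and not only a maximal one, which leaves
  -- another pairing no freedom.
  ∧-≤-mm : MeetSemidistributive → ∀ {i s w} → i ∈ xs → JIw a b (jj i) s → w ≤ b → s ≡ jj i ∧ w
    → w ≤ mm i
  ∧-≤-mm msd {i} {s} {w} i∈xs jw w≤b s≡j∧w with mm∈𝓜 i∈xs jw
  ... | (a≤m , m≤b) , s≡j∧m , max = subst (w ≤_) (max (w ∨ mm i)
          (≤-trans a≤m (y≤x∨y w (mm i)) , ∨-least w≤b m≤b)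
          (trans s≡j∧w (sym (msd (jj i) w (mm i) (trans (sym s≡j∧w) s≡j∧m))))
          (y≤x∨y w (mm i))) (x≤x∨y w (mm i))

  unique-SD : Semidistributive → ∀ κ' → Pairing a b κ' → ∀ j → JI a b j → κ' j ≡ κ j
  unique-SD (_ , msd) κ' P j ji@(s , jw) with JI-jj ji
  ... | i , i∈xs , refl with Pairing.κ∈𝓜 P j s jw | mm∈𝓜 i∈xs jw
  ...   | (_ , w≤b) , e , max | m∈I , e′ , _ =
    trans (sym (max (mm i) m∈I e′ (∧-≤-mm msd i∈xs jw w≤b e))) (sym (κ-jj i∈xs))

  -- Induction on rank. Write `κ' (jj i)` as `mm k`. A larger rank of `k` would put `jj i` below its
  -- own image; a smaller one makes `mm k` already the image of `jj k`, so injectivity identifies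
  -- `jj k` with `jj i`.
  unique-Ordered : Ordered L xs jj mm → ∀ κ' → Pairing a b κ' → ∀ j → JI a b j → κ' j ≡ κ j
  unique-Ordered ord κ' P j ji with JI-jj ji
  ... | i , i∈xs , refl = trans (go i∈xs (ℕI.<-wellFounded (rank i))) (sym (κ-jj i∈xs))
    where
    open Ordered ord

    j≰κ' : ∀ {j} → JI a b j → ¬ j ≤ κ' j
    j≰κ' {j} (s , jw@(_ , _ , s⋖j , _)) j≤κ'j with Pairing.κ∈𝓜 P j s jw
    ... | _ , e , _ = proj₂ (proj₁ s⋖j) (trans e (x≤y⇒x∧y≡x j≤κ'j))

    go : ∀ {i} → i ∈ xs → Acc _<ℕ_ (rank i) → κ' (jj i) ≡ mm i
    go {i} i∈xs (acc rs) with MI-mm (Pairing.toMI P (jj i) (jj-JI i∈xs))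
    ... | k , k∈xs , e with ℕP.<-cmp (rank i) (rank k)
    ...   | tri< i<k _ _ =
            ⊥-elim (j≰κ' (jj-JI i∈xs) (subst (jj i ≤_) e (rank-< i∈xs k∈xs i<k)))
    ...   | tri≈ _ i≡k _ = trans (sym e) (cong mm (sym (rank-injective i≡k)))
    ...   | tri> _ _ k<i = trans (sym e) (jj⇒mm k∈xs i∈xs
            (Pairing.injective P _ _ (jj-JI k∈xs) (jj-JI i∈xs) (trans (go k∈xs (rs k<i)) e)))

  uniquePairing : Kind L xs jj mm → UniquePairing a b κ
  uniquePairing (inj₁ sd) = pairing , unique-SD sd
  uniquePairing (inj₂ ord) = pairing , unique-Ordered ord

-- Labellings of intervals

module _ {L : FinLattice} {I : Set} {xs : List I} {jj mm : I → Notions.Elt L} where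
  -- The proof components of `dual (dual L)` differ from those of `L`, so applying `dual-labelling`
  -- twice does not return to `L`. This inverse carries the result on upper intervals over to lower
  -- ones.
  undual-labelling : ∀ {a b} → Labelling (dual L) b a xs mm jj → Labelling L a b xs jj mm
  undual-labelling d = record
    { jj-JI = JI-undual ∘ mm-MI
    ; mm-MI = MI-undual ∘ jj-JI
    ; JI-jj = MI-mm ∘ JI-dual
    ; MI-mm = JI-jj ∘ MI-dual
    ; jj⇒mm = mm⇒jj
    ; mm⇒jj = jj⇒mm
    ; jj≰mm = jj≰mm
    ; label = λ a≤y z≤b y⋖z → let (i , i∈xs , ≤mm , jj≤) = label z≤b a≤y (⋖-dual y⋖z)
                               in i , i∈xs , jj≤ , ≤mm
    }
    where
    open Labelling d
    open Conversions L

-- Used with `x` the lower end `e` of an upper interval: joining with `e` then keeps different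
-- join-irreducibles apart and their images join-irreducible.
Absorbing : (L : FinLattice) {I : Set} (xs : List I) (jj mm : I → Notions.Elt L) → Set
Absorbing L {I} xs jj mm = ∀ {i k x} → i ∈ xs → k ∈ xs → x ≤ mm i → x ≤ mm k
  → jj k ≤ (x ∨ jj i) → ¬ jj k ≤ mm i → jj i ≤ jj k
  where open FinLattice L

TwoCycleFree : (L : FinLattice) {I : Set} (xs : List I) (jj mm : I → Notions.Elt L) → Set
TwoCycleFree L xs jj mm = ∀ {i k} → i ∈ xs → k ∈ xs → i ≡ k ⊎ jj i ≤ mm k ⊎ jj k ≤ mm i
  where open FinLattice L

module Absorption {L : FinLattice} {a b : Notions.Elt L} {I : Set} {xs : List I}
                  {jj mm : I → Notions.Elt L} (d : Labelling L a b xs jj mm) where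
  open LabellingPairing d

  -- Semidistributive case: `mm i` has the same join, its cover `t`, with `jj i` and with `jj k`,
  -- hence also with `jj i ∧ jj k`. Were `jj i ≤ jj k` false, that meet would be below `mm i`, and
  -- so would `jj i`. Without 2-cycles, only the alternative `i ≡ k` survives the hypotheses.
  absorbing : Semidistributive ⊎ TwoCycleFree L xs jj mm → Absorbing L xs jj mm
  absorbing (inj₁ (jsd , _)) {i} {k} {x} i∈xs k∈xs x≤mi _ jk≤ jk≰mi with mm-MI i∈xs | jj i ≤? jj k
  ... | _ | yes ji≤jk = ji≤jk
  ... | t , mw@(_ , _ , m⋖t , _) | no ji≰jk = ⊥-elim (jj≰mm i∈xs ji≤mi)
    where
    ji≤t : jj i ≤ t
    ji≤t = jj≤upper-cover i∈xs mw

    jk≤t : jj k ≤ t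
    jk≤t = ≤-trans jk≤ (∨-least (≤-trans x≤mi (⋖⇒≤ m⋖t)) ji≤t)

    same-join : mm i ∨ jj i ≡ mm i ∨ jj k
    same-join = trans (⋖-join≡ m⋖t ji≤t (jj≰mm i∈xs)) (sym (⋖-join≡ m⋖t jk≤t jk≰mi))

    meet≤mi : (jj i ∧ jj k) ≤ mm i
    meet≤mi = lower≤mm i∈xs
      (∧-greatest (proj₁ (proj₁ (proj₂ (jj-JI i∈xs)))) (proj₁ (proj₁ (proj₂ (jj-JI k∈xs)))))
      (x∧y≤x _ _) (ji≰jk ∘ x∧y≡x⇒x≤y)

    ji≤mi : jj i ≤ mm i
    ji≤mi = ≤-trans (y≤x∨y (mm i) (jj i))
      (subst (_≤ mm i) (jsd (mm i) (jj i) (jj k) same-join) (∨-least ≤-refl meet≤mi))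
  absorbing (inj₂ free) {i} {k} i∈xs k∈xs _ x≤mk jk≤ jk≰mi with free i∈xs k∈xs
  ... | inj₁ refl = ≤-refl
  ... | inj₂ (inj₁ ji≤mk) = ⊥-elim (jj≰mm k∈xs (≤-trans jk≤ (∨-least x≤mk ji≤mk)))
  ... | inj₂ (inj₂ jk≤mi) = ⊥-elim (jk≰mi jk≤mi)

module UpperInterval {L : FinLattice} {a b : Notions.Elt L} {I : Set} {xs : List I}
                     {jj mm : I → Notions.Elt L} (d : Labelling L a b xs jj mm)
                     (absorb : Absorbing L xs jj mm)
                     (e : Notions.Elt L) (a≤e : FinLattice._≤_ L a e) (e≤b : FinLattice._≤_ L e b) where
  open LabellingPairing d

  ys : List I
  ys = filter (λ i → e ≤? mm i) xs

  ys⁻ : ∀ {i} → i ∈ ys → i ∈ xs × e ≤ mm i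
  ys⁻ = ∈-filter⁻ (λ i → e ≤? mm i)

  ys⁺ : ∀ {i} → i ∈ xs → e ≤ mm i → i ∈ ys
  ys⁺ = ∈-filter⁺ (λ i → e ≤? mm i)

  -- Raising the lower end of an interval changes no upper covers inside it, so the
  -- meet-irreducibles of `[e , b]` are exactly those of `[a , b]` above `e`. This is why `mm` is
  -- kept as it is.
  MI-restrict : ∀ {m} → MI a b m → e ≤ m → MI e b m
  MI-restrict (t , (_ , m≤b) , (_ , t≤b) , m⋖t , unique) e≤m =
    t , (e≤m , m≤b) , (≤-trans e≤m (⋖⇒≤ m⋖t) , t≤b) , m⋖t ,
    λ { z (e≤z , z≤b) → unique z (≤-trans a≤e e≤z , z≤b) }

  MI-extend : ∀ {m} → MI e b m → MI a b m × e ≤ m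
  MI-extend (t , (e≤m , m≤b) , (e≤t , t≤b) , m⋖t , unique) =
    (t , (≤-trans a≤e e≤m , m≤b) , (≤-trans a≤e e≤t , t≤b) , m⋖t ,
      λ { z (_ , z≤b) m⋖z → unique z (≤-trans e≤m (⋖⇒≤ m⋖z) , z≤b) m⋖z }) , e≤m

  JI-join : ∀ {p} → JI e b p → ∃ λ i → i ∈ ys × e ∨ jj i ≡ p
  JI-join {p} (s , jw@((e≤p , p≤b) , (e≤s , _) , s⋖p , _)) with label (≤-trans a≤e e≤s) p≤b s⋖p
  ... | i , i∈xs , ji≤p , s≤mi = i , ys⁺ i∈xs (≤-trans e≤s s≤mi) ,
    -- Otherwise `e ∨ jj i` is properly below `p`, hence below its lower cover `s` and so below
    -- `mm i`.
    decidable-stable ((e ∨ jj i) F.≟ p) λ ≢p → jj≰mm i∈xs (≤-trans (y≤x∨y e (jj i))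
      (≤-trans (join-irreducible-cover jw (∨-least e≤p ji≤p) (x≤x∨y e (jj i)) ≢p) s≤mi))

  ∨-cancel : ∀ {i k} → i ∈ ys → k ∈ ys → e ∨ jj i ≡ e ∨ jj k → jj i ≡ jj k
  ∨-cancel i∈ys k∈ys eq = antisym (half i∈ys k∈ys eq) (half k∈ys i∈ys (sym eq))
    where
    half : ∀ {i k} → i ∈ ys → k ∈ ys → e ∨ jj i ≡ e ∨ jj k → jj i ≤ jj k
    half {i} {k} i∈ys k∈ys eq with ys⁻ i∈ys | ys⁻ k∈ys
    ... | i∈xs , e≤mi | k∈xs , e≤mk = absorb i∈xs k∈xs e≤mi e≤mk
      (subst (jj k ≤_) (sym eq) (y≤x∨y e (jj k)))
      (λ jk≤mi → jj≰mm i∈xs (≤-trans (y≤x∨y e (jj i))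
        (subst (_≤ mm i) (sym eq) (∨-least e≤mi jk≤mi))))

  join-JI : ∀ {i} → i ∈ ys → JI e b (e ∨ jj i)
  join-JI {i} i∈ys with ys⁻ i∈ys
  ... | i∈xs , e≤mi with minimal-JI {e} {b} (x≤x∨y e (jj i))
                           (∨-least e≤b (proj₂ (proj₁ (proj₂ (jj-JI i∈xs))))) e≤mi
                           (jj≰mm i∈xs ∘ ≤-trans (y≤x∨y e (jj i)))
  ...   | p , s , jw , p≤ , p≰mi , _ with JI-join (s , jw)
  ...     | k , k∈ys , refl with ys⁻ k∈ys
  ...       | k∈xs , e≤mk = subst (JI e b) (antisym p≤ (∨-monoʳ e ji≤jk)) (s , jw)
    where
    ji≤jk : jj i ≤ jj k
    ji≤jk = absorb i∈xs k∈xs e≤mi e≤mk (≤-trans (y≤x∨y e (jj k)) p≤)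
      (λ jk≤mi → p≰mi (∨-least e≤mi jk≤mi))

  upper-labelling : Labelling L e b ys (λ i → e ∨ jj i) mm
  upper-labelling = record
    { jj-JI = join-JI
    ; mm-MI = λ i∈ys → let (i∈xs , e≤mi) = ys⁻ i∈ys in MI-restrict (mm-MI i∈xs) e≤mi
    ; JI-jj = JI-join
    ; MI-mm = upper-MI-mm
    ; jj⇒mm = λ i∈ys k∈ys eq →
        jj⇒mm (proj₁ (ys⁻ i∈ys)) (proj₁ (ys⁻ k∈ys)) (∨-cancel i∈ys k∈ys eq)
    ; mm⇒jj = λ i∈ys k∈ys eq → cong (e ∨_) (mm⇒jj (proj₁ (ys⁻ i∈ys)) (proj₁ (ys⁻ k∈ys)) eq)
    ; jj≰mm = λ {i} i∈ys → jj≰mm (proj₁ (ys⁻ i∈ys)) ∘ ≤-trans (y≤x∨y e (jj i))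
    ; label = upper-label
    }
    where
    upper-MI-mm : ∀ {m} → MI e b m → ∃ λ i → i ∈ ys × mm i ≡ m
    upper-MI-mm mi with MI-extend mi
    ... | mi′ , e≤m with MI-mm mi′
    ...   | i , i∈xs , refl = i , ys⁺ i∈xs e≤m , refl

    upper-label : ∀ {y z} → e ≤ y → z ≤ b → y ⋖ z → ∃ λ i → i ∈ ys × (e ∨ jj i) ≤ z × y ≤ mm i
    upper-label e≤y z≤b y⋖z with label (≤-trans a≤e e≤y) z≤b y⋖z
    ... | i , i∈xs , ji≤z , y≤mi = i , ys⁺ i∈xs (≤-trans e≤y y≤mi) ,
      ∨-least (≤-trans e≤y (⋖⇒≤ y⋖z)) ji≤z , y≤mi

module LowerInterval {L : FinLattice} {a b : Notions.Elt L} {I : Set} {xs : List I}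
                     {jj mm : I → Notions.Elt L} (d : Labelling L a b xs jj mm)
                     (absorb : Absorbing (dual L) xs mm jj)
                     (f : Notions.Elt L) (a≤f : FinLattice._≤_ L a f) (f≤b : FinLattice._≤_ L f b) where
  private
    module U = UpperInterval (dual-labelling d) absorb f f≤b a≤f
  open FinLattice L
  open Notions L
  open Conversions L

  zs : List I
  zs = U.ys

  zs⁻ : ∀ {i} → i ∈ zs → i ∈ xs × jj i ≤ f
  zs⁻ = U.ys⁻

  zs⁺ : ∀ {i} → i ∈ xs → jj i ≤ f → i ∈ zs
  zs⁺ = U.ys⁺

  ∧-cancel : ∀ {i k} → i ∈ zs → k ∈ zs → f ∧ mm i ≡ f ∧ mm k → mm i ≡ mm k
  ∧-cancel = U.∨-cancel

  lower-labelling : Labelling L a f zs jj (λ i → f ∧ mm i)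
  lower-labelling = undual-labelling U.upper-labelling

-- Prime pairs and dismantling

module DismantlingStep {L : FinLattice} {a b : Notions.Elt L} {I : Set} {xs : List I}
                       {jj mm : I → Notions.Elt L} (d : Labelling L a b xs jj mm)
                       (kind : Kind L xs jj mm) where
  open Uniqueness d

  weak : Semidistributive ⊎ TwoCycleFree L xs jj mm
  weak = Sum.map₂ free kind
    where
    free : Ordered L xs jj mm → TwoCycleFree L xs jj mm
    free ord {i} {k} i∈xs k∈xs with ℕP.<-cmp (Ordered.rank ord i) (Ordered.rank ord k)
    ... | tri< i<k _ _ = inj₂ (inj₁ (Ordered.rank-< ord i∈xs k∈xs i<k))
    ... | tri≈ _ i≡k _ = inj₁ (Ordered.rank-injective ord i≡k)
    ... | tri> _ _ k<i = inj₂ (inj₂ (Ordered.rank-< ord k∈xs i∈xs k<i))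

  absorb : Absorbing L xs jj mm
  absorb = Absorption.absorbing d weak

  coabsorb : Absorbing (dual L) xs mm jj
  coabsorb = Absorption.absorbing (dual-labelling d)
    (Sum.map (λ { (jsd , msd) → msd , jsd })
             (λ free i∈xs k∈xs → Sum.map₂ Sum.swap (free i∈xs k∈xs)) weak)

  -- Together with `jj≰mm` this makes `(jj i , mm i)` a prime pair of `[a , b]`.
  Prime : I → Set
  Prime i = ∀ x → InI a b x → ¬ jj i ≤ x → x ≤ mm i

  -- The `p` found here is an atom of `[a , b]`. An `x` not above it meets it in `a`, and `mm i` is
  -- above every element with that meet.
  prime-SD : MeetSemidistributive → ¬ b ≤ a → a ≤ b → ∃ λ i → i ∈ xs × Prime i
  prime-SD msd b≰a a≤b with minimal-JI a≤b ≤-refl ≤-refl b≰a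
  ... | p , s , jw@((a≤p , _) , (a≤s , _) , _) , p≤b , p≰a , s≤a with JI-jj (s , jw)
  ...   | i , i∈xs , refl = i , i∈xs , λ { x (a≤x , x≤b) j≰x → ∧-≤-mm msd i∈xs jw x≤b
          (antisym (≤-trans s≤a (∧-greatest a≤p a≤x))
            (join-irreducible-cover jw (x∧y≤x _ _) (∧-greatest a≤p a≤x)
              (j≰x ∘ x∧y≡x⇒x≤y))) }

  -- Choose `i` of least rank. If `x` is not above `jj i`, some meet-irreducible `mm k` lies above
  -- `x` but not above `jj i`. The order forbids a larger rank of `k` and the choice of `i` a
  -- smaller one, so `k` is `i`.
  prime-Ordered : Ordered L xs jj mm → ¬ b ≤ a → a ≤ b → ∃ λ i → i ∈ xs × Prime i
  prime-Ordered ord b≰a a≤b with minimal-JI a≤b ≤-refl ≤-refl b≰a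
  ... | p , s , jw , _ with JI-jj (s , jw)
  ...   | i , i∈xs , _ = least i∈xs (ℕI.<-wellFounded (rank i))
    where
    open Ordered ord

    least : ∀ {i} → i ∈ xs → Acc _<ℕ_ (rank i) → ∃ λ i → i ∈ xs × Prime i
    least {i} i∈xs (acc rs) with any? (λ k → rank k ℕP.<? rank i) xs
    ... | yes smaller = let (k , k∈xs , k<i) = find smaller in least k∈xs (rs k<i)
    ... | no none = i , i∈xs , prime
      where
      prime : Prime i
      prime x (a≤x , x≤b) j≰x
        with maximal-MI a≤x x≤b (proj₂ (proj₁ (proj₂ (jj-JI i∈xs)))) j≰x
      ... | q , t , mw , x≤q , j≰q , _ with MI-mm (t , mw)
      ...   | k , k∈xs , refl with ℕP.<-cmp (rank i) (rank k)
      ...     | tri< i<k _ _ = ⊥-elim (j≰q (rank-< i∈xs k∈xs i<k))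
      ...     | tri≈ _ i≡k _ = subst (λ h → x ≤ mm h) (sym (rank-injective i≡k)) x≤q
      ...     | tri> _ _ k<i = ⊥-elim (none (lose k∈xs k<i))

  abstract
    prime : ¬ b ≤ a → a ≤ b → ∃ λ i → i ∈ xs × Prime i
    prime = Sum.[ prime-SD ∘ proj₂ , prime-Ordered ]′ kind

  module Upper (e : Elt) (a≤e : a ≤ e) (e≤b : e ≤ b) where
    open UpperInterval d absorb e a≤e e≤b public
    open PairingMap L ys (λ i → e ∨ jj i) mm using () renaming (κ to κ₁) public
    private
      κ₁-jj : ∀ {i} → i ∈ ys → κ₁ (e ∨ jj i) ≡ mm i
      κ₁-jj = PairingMap.κ-jj L ys (λ i → e ∨ jj i) mm (Labelling.jj⇒mm upper-labelling)

    condI : CondI a b κ e κ₁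
    condI = record { maps = maps ; inj = inj ; surj = surj }
      where
      maps : ∀ j → JI a b j → e ≤ κ j → JI e b (e ∨ j) × κ₁ (e ∨ j) ≡ κ j
      maps j ji e≤κj with JI-jj ji
      ... | i , i∈xs , refl = join-JI i∈ys , trans (κ₁-jj i∈ys) (sym (κ-jj i∈xs))
        where
        i∈ys : i ∈ ys
        i∈ys = ys⁺ i∈xs (subst (e ≤_) (κ-jj i∈xs) e≤κj)

      inj : ∀ j j' → JI a b j → JI a b j' → e ≤ κ j → e ≤ κ j' → e ∨ j ≡ e ∨ j' → j ≡ j'
      inj j j' ji ji' e≤κj e≤κj' with JI-jj ji | JI-jj ji'
      ... | i , i∈xs , refl | k , k∈xs , refl =
        ∨-cancel (ys⁺ i∈xs (subst (e ≤_) (κ-jj i∈xs) e≤κj))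
                 (ys⁺ k∈xs (subst (e ≤_) (κ-jj k∈xs) e≤κj'))

      surj : ∀ j' → JI e b j' → ∃ λ j → JI a b j × e ≤ κ j × e ∨ j ≡ j'
      surj j' ji with JI-join ji
      ... | i , i∈ys , eq with ys⁻ i∈ys
      ...   | i∈xs , e≤mi = jj i , jj-JI i∈xs , subst (e ≤_) (sym (κ-jj i∈xs)) e≤mi , eq

    -- Semidistributivity is a property of the whole lattice and is passed on as it is. In the
    -- ordered case the old ranks still work, since `e` is below every `mm k` that survives the
    -- filter.
    upper-kind : Kind L ys (λ i → e ∨ jj i) mm
    upper-kind = Sum.map₂ (λ ord → record
      { rank = Ordered.rank ord
      ; rank-injective = Ordered.rank-injective ord
      ; rank-< = λ i∈ys k∈ys i<k →
          ∨-least (proj₂ (ys⁻ k∈ys)) (Ordered.rank-< ord (proj₁ (ys⁻ i∈ys)) (proj₁ (ys⁻ k∈ys)) i<k)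
      }) kind

    ys-shorter : ∀ {i} → i ∈ xs → ¬ e ≤ mm i → length ys <ℕ length xs
    ys-shorter i∈xs e≰mi = filter-notAll _ xs (lose i∈xs e≰mi)

  module Lower (f : Elt) (a≤f : a ≤ f) (f≤b : f ≤ b) where
    open LowerInterval d coabsorb f a≤f f≤b public
    open PairingMap L zs jj (λ i → f ∧ mm i) using () renaming (κ to κ₂) public
    private
      κ₂-jj : ∀ {i} → i ∈ zs → κ₂ (jj i) ≡ f ∧ mm i
      κ₂-jj = PairingMap.κ-jj L zs jj (λ i → f ∧ mm i) (Labelling.jj⇒mm lower-labelling)

    condII : CondII a b κ f κ₂
    condII = record { maps = maps ; inj = inj ; surj = surj }
      where
      maps : ∀ j → JI a b j → j ≤ f → MI a f (f ∧ κ j) × JI a f j × κ₂ j ≡ f ∧ κ j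
      maps j ji j≤f with JI-jj ji
      ... | i , i∈xs , refl =
        subst (MI a f) (sym f∧κ) (Labelling.mm-MI lower-labelling i∈zs) ,
        Labelling.jj-JI lower-labelling i∈zs ,
        trans (κ₂-jj i∈zs) (sym f∧κ)
        where
        i∈zs : i ∈ zs
        i∈zs = zs⁺ i∈xs j≤f

        f∧κ : f ∧ κ (jj i) ≡ f ∧ mm i
        f∧κ = cong (f ∧_) (κ-jj i∈xs)

      inj : ∀ j j' → JI a b j → JI a b j' → j ≤ f → j' ≤ f → f ∧ κ j ≡ f ∧ κ j' → κ j ≡ κ j'
      inj j j' ji ji' j≤f j'≤f eq with JI-jj ji | JI-jj ji'
      ... | i , i∈xs , refl | k , k∈xs , refl =
        trans (κ-jj i∈xs) (trans
          (∧-cancel (zs⁺ i∈xs j≤f) (zs⁺ k∈xs j'≤f)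
            (trans (cong (f ∧_) (sym (κ-jj i∈xs))) (trans eq (cong (f ∧_) (κ-jj k∈xs)))))
          (sym (κ-jj k∈xs)))

      surj : ∀ m' → MI a f m' → ∃ λ j → JI a b j × j ≤ f × f ∧ κ j ≡ m'
      surj m' mi with Labelling.MI-mm lower-labelling mi
      ... | i , i∈zs , eq with zs⁻ i∈zs
      ...   | i∈xs , j≤f = jj i , jj-JI i∈xs , j≤f , trans (cong (f ∧_) (κ-jj i∈xs)) eq

    lower-kind : Kind L zs jj (λ i → f ∧ mm i)
    lower-kind = Sum.map₂ (λ ord → record
      { rank = Ordered.rank ord
      ; rank-injective = Ordered.rank-injective ord
      ; rank-< = λ i∈zs k∈zs i<k →
          ∧-greatest (proj₂ (zs⁻ i∈zs)) (Ordered.rank-< ord (proj₁ (zs⁻ i∈zs)) (proj₁ (zs⁻ k∈zs)) i<k)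
      }) kind

    zs-shorter : ∀ {i} → i ∈ xs → ¬ jj i ≤ f → length zs <ℕ length xs
    zs-shorter i∈xs j≰f = filter-notAll _ xs (lose i∈xs j≰f)

module Dismantling (L : FinLattice) where
  open Lattice L

  compDism : ∀ {a b} {I : Set} {xs : List I} {jj mm : I → Elt} → a ≤ b
    → Labelling L a b xs jj mm → Kind L xs jj mm → CompDism a b (PairingMap.κ L xs jj mm)
  compDism {xs = xs} a≤b d kind = go a≤b d kind (ℕI.<-wellFounded (length xs))
    where
    go : ∀ {a b} {I : Set} {xs : List I} {jj mm : I → Elt} → a ≤ b
      → Labelling L a b xs jj mm → Kind L xs jj mm → Acc _<ℕ_ (length xs)
      → CompDism a b (PairingMap.κ L xs jj mm)
    go {a} {b} {jj = jj} {mm} a≤b d kind (acc rs) with b ≤? a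
    ... | yes b≤a = trivial (antisym a≤b b≤a) (Uniqueness.uniquePairing d kind)
    ... | no b≰a with DismantlingStep.prime d kind b≰a a≤b
    ...   | i , i∈xs , prime =
      dismantle (Uniqueness.uniquePairing d kind) (jj i) (mm i)
        (j∈I , m∈I , covered , λ x _ x≤m j≤x → j≰m (≤-trans j≤x x≤m))
        U.κ₁ W.κ₂
        -- Since `jj i` is not below `mm i`, both filters drop `i` itself, and both lists get
        -- shorter.
        (go (proj₂ j∈I) U.upper-labelling U.upper-kind (rs (U.ys-shorter i∈xs j≰m)))
        (go (proj₁ m∈I) W.lower-labelling W.lower-kind (rs (W.zs-shorter i∈xs j≰m)))
        U.condI W.condII
      where
      j∈I : InI a b (jj i)
      j∈I = proj₁ (proj₂ (Labelling.jj-JI d i∈xs))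

      m∈I : InI a b (mm i)
      m∈I = proj₁ (proj₂ (Labelling.mm-MI d i∈xs))

      j≰m : ¬ jj i ≤ mm i
      j≰m = Labelling.jj≰mm d i∈xs

      module U = DismantlingStep.Upper d kind (jj i) (proj₁ j∈I) (proj₂ j∈I)
      module W = DismantlingStep.Lower d kind (mm i) (proj₁ m∈I) (proj₂ m∈I)

      covered : ∀ x → InI a b x → x ≤ mm i ⊎ jj i ≤ x
      covered x x∈I with jj i ≤? x
      ... | yes j≤x = inj₂ j≤x
      ... | no j≰x = inj₁ (prime x x∈I j≰x)

-- Independence of labels

DownFree : (L : FinLattice) {I : Set} (xs : List I) (jj mm : I → Notions.Elt L) → Set
DownFree L xs jj mm = ∀ {i k x y y'} → i ∈ xs → k ∈ xs → y ⋖ x → y' ⋖ x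
  → y ≤ mm i → jj i ≤ x → y' ≤ mm k → jj k ≤ x → jj i ≢ jj k → jj i ≤ mm k
  where
  open FinLattice L
  open Notions L

module _ {L : FinLattice} where
  open Lattice L

  labelling⇒semidistrim : {I : Set} {xs : List I} {jj mm : I → Elt}
    → Labelling L bot top xs jj mm → Kind L xs jj mm
    → DownFree L xs jj mm → DownFree (dual L) xs mm jj → Semidistrim
  labelling⇒semidistrim {xs = xs} {jj} {mm} d kind down up =
    κ , Dismantling.compDism L (minimum top) d kind , downIndep , upIndep
    where
    open Uniqueness d using (κ; κ-jj; JI-jj; mm⇒jj)

    downIndep : DownIndep κ
    downIndep x y y' j j' y⋖x y'⋖x (ji , y≤κ , j≤x) (ji' , y'≤κ , j'≤x) (j≢j' , j≰κj')
      with JI-jj ji | JI-jj ji'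
    ... | i , i∈xs , refl | k , k∈xs , refl = j≰κj' (subst (jj i ≤_) (sym (κ-jj k∈xs))
      (down i∈xs k∈xs y⋖x y'⋖x (subst (y ≤_) (κ-jj i∈xs) y≤κ) j≤x
        (subst (y' ≤_) (κ-jj k∈xs) y'≤κ) j'≤x j≢j'))

    upIndep : UpIndep κ
    upIndep x y y' j j' x⋖y x⋖y' (ji , x≤κ , j≤y) (ji' , x≤κ' , j'≤y') (j≢j' , j≰κj')
      with JI-jj ji | JI-jj ji'
    ... | i , i∈xs , refl | k , k∈xs , refl = j≰κj' (subst (jj i ≤_) (sym (κ-jj k∈xs))
      -- Dualising exchanges `jj` with `mm`, so the two indices are swapped to obtain `jj i ≤ mm k`
      -- again.
      (up k∈xs i∈xs (⋖-dual x⋖y') (⋖-dual x⋖y) j'≤y' (subst (x ≤_) (κ-jj k∈xs) x≤κ')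
        j≤y (subst (x ≤_) (κ-jj i∈xs) x≤κ) (λ e → j≢j' (sym (mm⇒jj k∈xs i∈xs e)))))

  module SemidistributiveIndependence {I : Set} {xs : List I} {jj mm : I → Elt}
      (jsd : JoinSemidistributive) (d : Labelling L bot top xs jj mm) where
    open LabellingPairing d using (jj≰mm; lower≤mm)

    jj≰ : ∀ {i y} → i ∈ xs → y ≤ mm i → ¬ jj i ≤ y
    jj≰ i∈xs y≤mi ji≤y = jj≰mm i∈xs (≤-trans ji≤y y≤mi)

    -- Join-semidistributivity gives `y ∨ (jj i ∧ w) ≡ y ∨ jj i`. If `jj i` is not below `w`, the
    -- meet is properly below `jj i`, so the left side is below `mm i`, and then so is `jj i`.
    jj-least : ∀ {i y w} → i ∈ xs → y ≤ mm i → y ∨ jj i ≡ y ∨ w → jj i ≤ w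
    jj-least {i} {y} {w} i∈xs y≤mi e = decidable-stable (jj i ≤? w) λ ji≰w → jj≰mm i∈xs
      (≤-trans (y≤x∨y y (jj i)) (subst (_≤ mm i) (jsd y (jj i) w e)
        (∨-least y≤mi (lower≤mm i∈xs (minimum _) (x∧y≤x _ _) (ji≰w ∘ x∧y≡x⇒x≤y)))))

    -- For different covers, `y ∨ jj i` and `y ∨ y'` are both `x`, so `jj-least` puts `jj i` below
    -- `y'`. For a single cover, `jj-least` applied both ways shows that its label is unique.
    downFree : DownFree L xs jj mm
    downFree {i} {k} {x} {y} {y'} i∈xs k∈xs y⋖x y'⋖x y≤mi ji≤x y'≤mk jk≤x ji≢jk with y F.≟ y'
    ... | no y≢y' = ≤-trans (jj-least i∈xs y≤mi (trans (⋖-join≡ y⋖x ji≤x (jj≰ i∈xs y≤mi))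
            (sym (⋖-join≡ y⋖x (⋖⇒≤ y'⋖x) (y≢y' ∘ ⋖-antichain y⋖x y'⋖x))))) y'≤mk
    ... | yes refl = ⊥-elim (ji≢jk (antisym
            (jj-least i∈xs y≤mi same-join) (jj-least k∈xs y'≤mk (sym same-join))))
      where
      same-join : y ∨ jj i ≡ y ∨ jj k
      same-join = trans (⋖-join≡ y⋖x ji≤x (jj≰ i∈xs y≤mi))
        (sym (⋖-join≡ y⋖x jk≤x (jj≰ k∈xs y'≤mk)))

-- Semidistributive lattices

module SemidistributiveLabelling (L : FinLattice) (sd : Notions.Semidistributive L) where
  open Lattice L

  private
    jsd : JoinSemidistributive
    jsd = proj₁ sd

    msd : MeetSemidistributive
    msd = proj₂ sd

    partner : ∀ {j} → JI bot top j → ∃₂ λ m t → ∃ λ s →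
      JIw bot top j s × MIw bot top m t × s ≤ m × ¬ j ≤ m × j ≤ t
    partner {j} (s , jw) =
      let (m , t , mw , s≤m , j≰m , j≤t) =
            maximal-MI (minimum s) (maximum s) (maximum j) (⋖⇒≰ (proj₁ (proj₂ (proj₂ jw))))
      in m , t , s , jw , mw , s≤m , j≰m , j≤t

    mm : Elt → Elt
    mm j with JI? bot top j
    ... | yes ji = proj₁ (partner ji)
    ... | no _ = j

    mm-spec : ∀ {j} → JI bot top j → ∃₂ λ t s →
      JIw bot top j s × MIw bot top (mm j) t × s ≤ mm j × ¬ j ≤ mm j × j ≤ t
    mm-spec {j} ji with JI? bot top j
    ... | yes ji′ = proj₂ (partner ji′)
    ... | no ¬ji = ⊥-elim (¬ji ji)

    below-cover : ∀ {j s w} → JIw bot top j s → w ≤ j → ¬ j ≤ w → w ≤ s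
    below-cover jw w≤j j≰w =
      join-irreducible-cover jw w≤j (minimum _) (λ e → j≰w (≤-reflexive (sym e)))

    above-cover : ∀ {m t w} → MIw bot top m t → m ≤ w → ¬ w ≤ m → t ≤ w
    above-cover mw m≤w w≰m = meet-irreducible-cover mw m≤w (maximum _) (w≰m ∘ ≤-reflexive)

    -- Both `w` and `mm j` meet `j` in its lower cover. If `w` were not below `mm j`, their join
    -- would lie above `t` and so above `j`, and meet-semidistributivity would make `j ∧ w` equal to
    -- `j`.
    mm-max : ∀ {j s w} → JIw bot top j s → s ≤ w → ¬ j ≤ w → w ≤ mm j
    mm-max {j} {s} {w} jw s≤w j≰w with mm-spec (s , jw)
    ... | t , s′ , jw′@(_ , _ , s′⋖j , _) , mw , s′≤m , j≰m , j≤t =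
      decidable-stable (w ≤? mm j) λ w≰m →
        j≰w (x∧y≡x⇒x≤y (trans (sym (msd j w (mm j) same-meet)) (x≤y⇒x∧y≡x
          (≤-trans j≤t (above-cover mw (y≤x∨y w (mm j)) (w≰m ∘ ≤-trans (x≤x∨y w (mm j))))))))
      where
      same-meet : j ∧ w ≡ j ∧ mm j
      same-meet = antisym
        (∧-greatest (x∧y≤x j w) (≤-trans
          (below-cover jw′ (x∧y≤x j w) (λ p → j≰w (≤-trans p (x∧y≤y j w)))) s′≤m))
        (∧-greatest (x∧y≤x j (mm j)) (≤-trans
          (below-cover jw (x∧y≤x j (mm j)) (λ p → j≰m (≤-trans p (x∧y≤y j (mm j))))) s≤w))

    xs : List Elt
    xs = filter (JI? bot top) (allFin size)

    xs⁻ : ∀ {j} → j ∈ xs → JI bot top j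
    xs⁻ = proj₂ ∘ ∈-filter⁻ (JI? bot top) {xs = allFin size}

    xs⁺ : ∀ {j} → JI bot top j → j ∈ xs
    xs⁺ {j} = ∈-filter⁺ (JI? bot top) (∈-allFin j)

    mm-injective : ∀ {j j'} → j ∈ xs → j' ∈ xs → mm j ≡ mm j' → j ≤ j'
    mm-injective {j} {j'} j∈xs j'∈xs e with mm-spec (xs⁻ j∈xs) | mm-spec (xs⁻ j'∈xs)
    ... | t , s , jw , mw , s≤m , j≰m , j≤t | t′ , _ , _ , mw′ , _ , j'≰m , j'≤t′ =
      decidable-stable (j ≤? j') λ j≰j' → j≰m (≤-trans (y≤x∨y (mm j) j)
        (subst (_≤ mm j) (jsd (mm j) j j' same-join) (∨-least ≤-refl
          (≤-trans (below-cover jw (x∧y≤x j j') (λ p → j≰j' (≤-trans p (x∧y≤y j j')))) s≤m))))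
      where
      m⋖t : mm j ⋖ t
      m⋖t = proj₁ (proj₂ (proj₂ mw))

      t′≤t : t′ ≤ t
      t′≤t = above-cover mw′ (subst (_≤ t) e (⋖⇒≤ m⋖t))
        (λ t≤m′ → j≰m (subst (j ≤_) (sym e) (≤-trans j≤t t≤m′)))

      same-join : mm j ∨ j ≡ mm j ∨ j'
      same-join = trans (⋖-join≡ m⋖t j≤t j≰m)
        (sym (⋖-join≡ m⋖t (≤-trans j'≤t′ t′≤t) (j'≰m ∘ subst (j' ≤_) e)))

    labelling : Labelling L bot top xs id mm
    labelling = record
      { jj-JI = xs⁻
      ; mm-MI = λ j∈xs → let (t , _ , _ , mw , _) = mm-spec (xs⁻ j∈xs) in t , mw
      ; JI-jj = λ {j} ji → j , xs⁺ ji , refl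
      ; MI-mm = MI-mm
      ; jj⇒mm = λ _ _ → cong mm
      ; mm⇒jj = λ j∈xs j'∈xs e →
          antisym (mm-injective j∈xs j'∈xs e) (mm-injective j'∈xs j∈xs (sym e))
      ; jj≰mm = λ j∈xs → let (_ , _ , _ , _ , _ , j≰m , _) = mm-spec (xs⁻ j∈xs) in j≰m
      ; label = label
      }
      where
      -- Take `p` minimal below `t` and not below `m`. Then `m ≤ mm p` by `mm-max`, and a strict
      -- inequality would put `mm p` above `t`, hence above `p`.
      MI-mm : ∀ {m} → MI bot top m → ∃ λ j → j ∈ xs × mm j ≡ m
      MI-mm {m} (t , mw@(_ , _ , m⋖t , _))
        with minimal-JI (minimum t) (maximum t) (minimum m) (⋖⇒≰ m⋖t)
      ... | p , s , jw , p≤t , p≰m , s≤m with mm-spec (s , jw)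
      ...   | _ , _ , _ , _ , _ , p≰mm , _ = p , xs⁺ (s , jw) , antisym
        (decidable-stable (mm p ≤? m) (λ mm≰m → p≰mm (≤-trans p≤t (above-cover mw m≤mm mm≰m))))
        m≤mm
        where
        m≤mm : m ≤ mm p
        m≤mm = mm-max jw s≤m p≰m

      label : ∀ {y z} → bot ≤ y → z ≤ top → y ⋖ z → ∃ λ j → j ∈ xs × j ≤ z × y ≤ mm j
      label {y} {z} ⊥≤y z≤⊤ y⋖z with minimal-JI (minimum z) z≤⊤ ⊥≤y (⋖⇒≰ y⋖z)
      ... | p , s , jw , p≤z , p≰y , s≤y = p , xs⁺ (s , jw) , p≤z , mm-max jw s≤y p≰y

  semidistributive⇒semidistrim : Semidistrim
  semidistributive⇒semidistrim = labelling⇒semidistrim labelling (inj₁ sd)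
    (SemidistributiveIndependence.downFree jsd labelling)
    (SemidistributiveIndependence.downFree msd (dual-labelling labelling))

-- Frames of left modular elements

record Frame (L : FinLattice) {I : Set} (lo hi jj mm : I → Notions.Elt L) : Set where
  open FinLattice L
  open Notions L
  field
    lo≤hi : ∀ i → lo i ≤ hi i
    separated : ∀ i k → hi i ≤ lo k ⊎ i ≡ k ⊎ hi k ≤ lo i
    lo-modular : ∀ i → LeftModularElt (lo i)
    hi-modular : ∀ i → LeftModularElt (hi i)
    lo≤mm : ∀ i → lo i ≤ mm i
    jj≤hi : ∀ i → jj i ≤ hi i
    jj≰mm : ∀ i → ¬ jj i ≤ mm i
    hi≤lo∨jj : ∀ i → hi i ≤ (lo i ∨ jj i)
    mm∧hi≤lo : ∀ i → (hi i ∧ mm i) ≤ lo i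
    jj-least : ∀ {i w} → ¬ (w ∧ hi i) ≤ lo i → jj i ≤ w
    mm-greatest : ∀ {i w} → ¬ hi i ≤ (w ∨ lo i) → w ≤ mm i
    cross-∨ : ∀ {q x} → ¬ x ≤ q → ∃ λ i → ¬ x ≤ (q ∨ lo i) × x ≤ (q ∨ hi i)
    cross-∧ : ∀ {q x} → ¬ q ≤ x → ∃ λ i → ¬ (q ∧ hi i) ≤ x × (q ∧ lo i) ≤ x

module _ {L : FinLattice} {I : Set} {lo hi jj mm : I → Notions.Elt L} where
  open Lattice L

  dual-leftModular : ∀ {x} → LeftModularElt x → Notions.LeftModularElt (dual L) x
  dual-leftModular {x} lm y z z≤y = trans (∨-comm (y ∧ x) z)
    (trans (cong (z ∨_) (∧-comm y x))
      (trans (sym (lm z y z≤y)) (trans (∧-comm (z ∨ x) y) (cong (y ∧_) (∨-comm z x)))))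
    where
    ∨-comm : ∀ x y → x ∨ y ≡ y ∨ x
    ∨-comm = Order.∧-comm (dual L)

  -- Exchanging `lo` with `hi` and `jj` with `mm` permutes the fields, so the independence argument
  -- for lower covers also serves for upper covers.
  dual-frame : Frame L lo hi jj mm → Frame (dual L) hi lo mm jj
  dual-frame f = record
    { lo≤hi = lo≤hi
    ; separated = λ i k → Sum.map₂ (Sum.map₁ sym) (separated k i)
    ; lo-modular = dual-leftModular ∘ hi-modular
    ; hi-modular = dual-leftModular ∘ lo-modular
    ; lo≤mm = jj≤hi
    ; jj≤hi = lo≤mm
    ; jj≰mm = jj≰mm
    ; hi≤lo∨jj = mm∧hi≤lo
    ; mm∧hi≤lo = hi≤lo∨jj
    ; jj-least = mm-greatest
    ; mm-greatest = jj-least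
    ; cross-∨ = cross-∧
    ; cross-∧ = cross-∨
    }
    where
    open Frame f

  module FrameIndependence (f : Frame L lo hi jj mm) where
    open Frame f

    -- As `jj h` is not below `u`, `jj-least` gives `hi h ∧ u ≤ lo h`. Left modularity of `hi h`
    -- turns `u ≤ q ∨ hi h` into `u ≤ q ∨ (hi h ∧ u)`.
    reach : ∀ {h q u x} → q ≤ u → u ≤ x → x ≤ (q ∨ hi h) → ¬ jj h ≤ u → u ≤ (q ∨ lo h)
    reach {h} {q} {u} q≤u u≤x x≤qhi jh≰u = ≤-trans (∧-greatest (≤-trans u≤x x≤qhi) ≤-refl)
      (≤-trans (≤-reflexive (hi-modular h q u q≤u))
        (∨-monoʳ q (decidable-stable ((hi h ∧ u) ≤? lo h)
          (λ ≰lo → jh≰u (jj-least (λ p → ≰lo (subst (_≤ lo h) (∧-comm u (hi h)) p)))))))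

    -- If h is the step at which (y ∧ y') ∨ c reaches x for c in the chain, then h = i
    -- and x ∧ ((y ∧ y') ∨ lo h) = y; this forces jj i ≤ y' ≤ mm k.
    downFree : ∀ {xs : List I} → DownFree L xs jj mm
    downFree {i = i} {k} {x} {y} {y'} _ _ y⋖x y'⋖x y≤mi ji≤x y'≤mk jk≤x ji≢jk =
      decidable-stable (jj i ≤? mm k) contra
      where
      contra : ¬ ¬ jj i ≤ mm k
      contra ji≰mk with separated i k
      ... | inj₁ hi≤lok = ji≰mk (≤-trans (jj≤hi i) (≤-trans hi≤lok (lo≤mm k)))
      ... | inj₂ (inj₁ refl) = ji≢jk refl
      ... | inj₂ (inj₂ hik≤loi) = main
        where
        q : Elt
        q = y ∧ y'

        below-y : ∀ {w} → w ≤ x → w ≤ mm i → w ≤ y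
        below-y w≤x w≤mi = ≤-trans (∧-greatest w≤mi w≤x)
          (⋖-meet y⋖x y≤mi (jj≰mm i ∘ ≤-trans ji≤x))

        jk≤y : jj k ≤ y
        jk≤y = below-y jk≤x (≤-trans (jj≤hi k) (≤-trans hik≤loi (lo≤mm i)))

        y'≰y : ¬ y' ≤ y
        y'≰y y'≤y = jj≰mm k (≤-trans (subst (jj k ≤_) (⋖-antichain y⋖x y'⋖x y'≤y) jk≤y) y'≤mk)

        x≰q : ¬ x ≤ q
        x≰q x≤q = ⋖⇒≰ y⋖x (≤-trans x≤q (x∧y≤x y y'))

        main : ⊥
        main with cross-∨ x≰q
        ... | h , x≰qlo , x≤qhi with jj h ≤? y | jj h ≤? y'
        -- With `jj h ≤ q`, already `q ∨ lo h` would contain `hi h` and reach `x`.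
        ...   | yes jh≤y | yes jh≤y' = x≰qlo (≤-trans x≤qhi (∨-least (x≤x∨y q (lo h))
                  (≤-trans (hi≤lo∨jj h) (∨-least (y≤x∨y q (lo h))
                    (≤-trans (∧-greatest jh≤y jh≤y') (x≤x∨y q (lo h)))))))
        -- Here `x ∧ (q ∨ lo h)` is `y'`. For `h` at or before `i`, left modularity of `lo h` makes
        -- it `q ∨ (lo h ∧ x)`, which is below `y`; for `h` after `i`, it contains `jj k`, against
        -- `y' ≤ mm k`.
        ...   | jh≤?y | no jh≰y' = case-y' (separated h i)
          where
          y'≤qlo : y' ≤ (q ∨ lo h)
          y'≤qlo = reach (x∧y≤y y y') (⋖⇒≤ y'⋖x) x≤qhi jh≰y'

          bound : ∀ {w} → w ≤ (q ∨ lo h) → w ≤ x → w ≤ y'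
          bound w≤ w≤x = ≤-trans (∧-greatest w≤ w≤x) (⋖-meet y'⋖x y'≤qlo x≰qlo)

          y'≤y : lo h ≤ lo i → y' ≤ y
          y'≤y loh≤loi = ≤-trans (∧-greatest y'≤qlo (⋖⇒≤ y'⋖x))
            (≤-trans (≤-reflexive (lo-modular h q x (≤-trans (x∧y≤x y y') (⋖⇒≤ y⋖x))))
              (∨-least (x∧y≤x y y') (below-y (x∧y≤y (lo h) x)
                (≤-trans (x∧y≤x (lo h) x) (≤-trans loh≤loi (lo≤mm i))))))

          case-y' : hi h ≤ lo i ⊎ h ≡ i ⊎ hi i ≤ lo h → ⊥
          case-y' (inj₁ hih≤loi) = y'≰y (y'≤y (≤-trans (lo≤hi h) hih≤loi))
          case-y' (inj₂ (inj₁ refl)) = y'≰y (y'≤y ≤-refl)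
          case-y' (inj₂ (inj₂ hii≤loh)) = jj≰mm k (≤-trans (bound
            (≤-trans (jj≤hi k) (≤-trans hik≤loi (≤-trans (lo≤hi i)
              (≤-trans hii≤loh (y≤x∨y q (lo h)))))) jk≤x) y'≤mk)
        -- Now `x ∧ (q ∨ lo h)` is `y`. A step before `i` gives `jj h ≤ mm i` and so `jj h ≤ y`; a
        -- step after gives `jj i ≤ y`; `h = i` gives `jj i ≤ y' ≤ mm k`. All three are excluded.
        ...   | no jh≰y | yes jh≤y' = case-y (separated h i)
          where
          y≤qlo : y ≤ (q ∨ lo h)
          y≤qlo = reach (x∧y≤x y y') (⋖⇒≤ y⋖x) x≤qhi jh≰y

          case-y : hi h ≤ lo i ⊎ h ≡ i ⊎ hi i ≤ lo h → ⊥
          case-y (inj₁ hih≤loi) = jh≰y (below-y (≤-trans jh≤y' (⋖⇒≤ y'⋖x))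
            (≤-trans (jj≤hi h) (≤-trans hih≤loi (lo≤mm i))))
          case-y (inj₂ (inj₁ refl)) = ji≰mk (≤-trans jh≤y' y'≤mk)
          case-y (inj₂ (inj₂ hii≤loh)) = jj≰mm i (≤-trans (∧-greatest
            (≤-trans (jj≤hi i) (≤-trans hii≤loh (y≤x∨y q (lo h)))) ji≤x)
            (≤-trans (⋖-meet y⋖x y≤qlo x≰qlo) y≤mi))

-- Chains and trim lattices

crossing : ∀ n {P : Fin (ℕ.suc n) → Set} → (∀ i → Dec (P i)) → P fzero → ¬ P (fromℕ n)
  → ∃ λ (i : Fin n) → P (inject₁ i) × ¬ P (fsuc i)
crossing ℕ.zero P? P₀ ¬Pₙ = ⊥-elim (¬Pₙ P₀)
crossing (ℕ.suc n) P? P₀ ¬Pₙ with P? (fsuc fzero)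
... | no ¬P₁ = fzero , P₀ , ¬P₁
... | yes P₁ = let (i , Pᵢ , ¬Pᵢ₊₁) = crossing n (P? ∘ fsuc) P₁ ¬Pₙ in fsuc i , Pᵢ , ¬Pᵢ₊₁

module Chains (L : FinLattice) where
  open Lattice L

  chain-mono : ∀ n (c : Fin (ℕ.suc n) → Elt) → (∀ (i : Fin n) → c (inject₁ i) ≤ c (fsuc i))
    → ∀ {i k} → toℕ i ≤ℕ toℕ k → c i ≤ c k
  chain-mono n c step {fzero} {fzero} _ = ≤-refl
  chain-mono (ℕ.suc n) c step {fzero} {fsuc k} _ =
    ≤-trans (step fzero) (chain-mono n (c ∘ fsuc) (step ∘ fsuc) {fzero} {k} z≤n)
  chain-mono (ℕ.suc n) c step {fsuc i} {fsuc k} (s≤s i≤k) =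
    chain-mono n (c ∘ fsuc) (step ∘ fsuc) i≤k

  chain-step-mono : ∀ n (c : Fin (ℕ.suc n) → Elt) → (∀ (i : Fin n) → c (inject₁ i) ≤ c (fsuc i))
    → ∀ {i k : Fin n} → toℕ i <ℕ toℕ k → c (fsuc i) ≤ c (inject₁ k)
  chain-step-mono n c step {i} {k} i<k =
    chain-mono n c step (subst (ℕ.suc (toℕ i) ≤ℕ_) (sym (toℕ-inject₁ k)) i<k)

  -- Pigeonhole: a missed `p` put before the values of `f` would give `n + 1` different entries in a
  -- list of length `n`.
  exhaustive : ∀ {P : Elt → Set} {n} (f : Fin n → Elt) → (∀ i → P (f i))
    → (∀ {i k} → f i ≡ f k → i ≡ k) → HasCard P n → ∀ {p} → P p → ∃ λ i → f i ≡ p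
  exhaustive {P} {n} f Pf f-injective (xs , _ , _ , complete , length≡n) {p} Pp =
    decidable-stable (F.any? (λ i → f i F.≟ p)) λ missing →
      ℕP.1+n≰n (subst (ℕ.suc n ≤ℕ_) length≡n
        (injective⇒≤ {f = λ i → index (g∈xs i)} (λ {i} {k} → g-injective missing ∘ index-injective i k)))
    where
    g : Fin (ℕ.suc n) → Elt
    g fzero = p
    g (fsuc i) = f i

    g∈xs : ∀ i → g i ∈ xs
    g∈xs fzero = complete p Pp
    g∈xs (fsuc i) = complete (f i) (Pf i)

    index-injective : ∀ i k → index (g∈xs i) ≡ index (g∈xs k) → g i ≡ g k
    index-injective i k e = trans (lookup-index (g∈xs i))
      (trans (cong (lookup xs) e) (sym (lookup-index (g∈xs k))))

    g-injective : ¬ (∃ λ i → f i ≡ p) → ∀ {i k} → g i ≡ g k → i ≡ k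
    g-injective missing {fzero} {fzero} _ = refl
    g-injective missing {fzero} {fsuc k} e = ⊥-elim (missing (k , sym e))
    g-injective missing {fsuc i} {fzero} e = ⊥-elim (missing (i , e))
    g-injective missing {fsuc i} {fsuc k} e = cong fsuc (f-injective e)

module LeftModularChain (L : FinLattice) {n : ℕ} (c : Fin (ℕ.suc n) → Notions.Elt L)
                        (mc : Notions.MaximalChain L n c)
                        (lm : ∀ i → Notions.LeftModularElt L (c i)) where
  open Lattice L
  open Chains L

  lo hi : Fin n → Elt
  lo i = c (inject₁ i)
  hi i = c (fsuc i)

  lo⋖hi : ∀ i → lo i ⋖ hi i
  lo⋖hi = proj₂ (proj₂ mc)

  hi≤lo : ∀ {i k} → toℕ i <ℕ toℕ k → hi i ≤ lo k
  hi≤lo = chain-step-mono n c (⋖⇒≤ ∘ lo⋖hi)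

  separated : ∀ i k → hi i ≤ lo k ⊎ i ≡ k ⊎ hi k ≤ lo i
  separated i k with ℕP.<-cmp (toℕ i) (toℕ k)
  ... | tri< i<k _ _ = inj₁ (hi≤lo i<k)
  ... | tri≈ _ i≡k _ = inj₂ (inj₁ (toℕ-injective i≡k))
  ... | tri> _ _ k<i = inj₂ (inj₂ (hi≤lo k<i))

  cross-∧ : ∀ {q x} → ¬ q ≤ x → ∃ λ i → ¬ (q ∧ hi i) ≤ x × (q ∧ lo i) ≤ x
  cross-∧ {q} {x} q≰x =
    let (i , lo≤ , hi≰) = crossing n (λ i → (q ∧ c i) ≤? x)
          (≤-trans (x∧y≤y q _) (subst (_≤ x) (sym (proj₁ mc)) (minimum x)))
          (λ p → q≰x (≤-trans (∧-greatest ≤-refl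
            (subst (q ≤_) (sym (proj₁ (proj₂ mc))) (maximum q))) p))
    in i , hi≰ , lo≤

  cross-∨ : ∀ {q x} → ¬ x ≤ q → ∃ λ i → ¬ x ≤ (q ∨ lo i) × x ≤ (q ∨ hi i)
  cross-∨ {q} {x} x≰q =
    -- Negated because `crossing` looks for a change from true to false: `x` is not reached at `bot`
    -- and is reached at `top`.
    let (i , lo≰ , hi≤) = crossing n (λ i → ¬? (x ≤? (q ∨ c i)))
          (λ p → x≰q (≤-trans p (∨-least ≤-refl
            (subst (_≤ q) (sym (proj₁ mc)) (minimum q)))))
          (λ p → p (≤-trans (subst (x ≤_) (sym (proj₁ (proj₂ mc))) (maximum x)) (y≤x∨y q _)))
    in i , lo≰ , decidable-stable (x ≤? (q ∨ hi i)) hi≤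

  -- A cover lo i ⋖ hi of left modular elements meets u in a cover or an equality, so a strict chain
  -- has at most one step at which the meet with hi i escapes.
  chain-length≤ : ∀ {k} (d : Fin (ℕ.suc k) → Elt) → (∀ (l : Fin k) → d (inject₁ l) < d (fsuc l))
    → k ≤ℕ n
  chain-length≤ {k} d step = injective⇒≤ {f = proj₁ ∘ escape} injective
    where
    Escapes : Fin k → Fin n → Set
    Escapes l i = ¬ (d (fsuc l) ∧ hi i) ≤ d (inject₁ l) × (d (fsuc l) ∧ lo i) ≤ d (inject₁ l)

    escape : ∀ l → ∃ (Escapes l)
    escape l = cross-∧ (λ p → proj₂ (step l) (antisym (proj₁ (step l)) p))

    distinct : ∀ {l m i} → toℕ l <ℕ toℕ m → Escapes l i → ¬ Escapes m i
    distinct {l} {m} {i} l<m (hi≰u , lo≤u) (hi≰u′ , lo≤u′) =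
      hi≰u (≤-trans (∧-greatest (x∧y≤x v (hi i)) (≤-trans v∧hi≤u′∧hi u′∧hi≤lo)) lo≤u)
      where
      v u′ v′ : Elt
      v = d (fsuc l)
      u′ = d (inject₁ m)
      v′ = d (fsuc m)

      v∧hi≤u′∧hi : (v ∧ hi i) ≤ (u′ ∧ hi i)
      v∧hi≤u′∧hi = ∧-greatest
        (≤-trans (x∧y≤x v (hi i)) (chain-step-mono k d (proj₁ ∘ step) l<m)) (x∧y≤y v (hi i))

      -- Otherwise `hi i ≤ u′ ∨ lo i`, and left modularity of `lo i` bounds `v′ ∧ hi i` by
      -- `u′ ∨ (lo i ∧ v′)`, which is `u′`: step `m` would not escape at `i`.
      u′∧hi≤lo : (u′ ∧ hi i) ≤ lo i
      u′∧hi≤lo = decidable-stable ((u′ ∧ hi i) ≤? lo i) λ ≰lo → hi≰u′ (≤-trans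
        (∧-greatest
          (≤-trans (x∧y≤y v′ (hi i)) (≤-trans (⋖-join (lo⋖hi i) (x∧y≤y u′ (hi i)) ≰lo)
            (∨-least (y≤x∨y u′ (lo i)) (≤-trans (x∧y≤x u′ (hi i)) (x≤x∨y u′ (lo i))))))
          (x∧y≤x v′ (hi i)))
        (≤-trans (≤-reflexive (lm (inject₁ i) u′ v′ (proj₁ (step m))))
          (∨-least ≤-refl (subst (_≤ u′) (∧-comm v′ (lo i)) lo≤u′))))

    injective : ∀ {l m} → proj₁ (escape l) ≡ proj₁ (escape m) → l ≡ m
    injective {l} {m} e with ℕP.<-cmp (toℕ l) (toℕ m)
    ... | tri< l<m _ _ = ⊥-elim (distinct l<m (proj₂ (escape l))
            (subst (Escapes m) (sym e) (proj₂ (escape m))))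
    ... | tri≈ _ l≡m _ = toℕ-injective l≡m
    ... | tri> _ _ m<l = ⊥-elim (distinct m<l (proj₂ (escape m))
            (subst (Escapes l) e (proj₂ (escape l))))

  module Extremality (ji-card : HasCard (JI bot top) n) (mi-card : HasCard (MI bot top) n) where
    private
      jw : ∀ i → ∃₂ λ p s → JIw bot top p s × p ≤ hi i × ¬ p ≤ lo i × s ≤ lo i
      jw i = minimal-JI (minimum (hi i)) (maximum (hi i)) (minimum (lo i)) (⋖⇒≰ (lo⋖hi i))

      mw : ∀ i → ∃₂ λ q t → MIw bot top q t × lo i ≤ q × ¬ hi i ≤ q × hi i ≤ t
      mw i = maximal-MI (minimum (lo i)) (maximum (lo i)) (maximum (hi i)) (⋖⇒≰ (lo⋖hi i))

    jj mm : Fin n → Elt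
    jj i = proj₁ (jw i)
    mm i = proj₁ (mw i)

    jj-JI : ∀ i → JI bot top (jj i)
    jj-JI i = let (_ , s , p , _) = jw i in s , p

    mm-MI : ∀ i → MI bot top (mm i)
    mm-MI i = let (_ , t , p , _) = mw i in t , p

    jj≤hi : ∀ i → jj i ≤ hi i
    jj≤hi i = let (_ , _ , _ , p , _) = jw i in p

    jj≰lo : ∀ i → ¬ jj i ≤ lo i
    jj≰lo i = let (_ , _ , _ , _ , p , _) = jw i in p

    lo≤mm : ∀ i → lo i ≤ mm i
    lo≤mm i = let (_ , _ , _ , p , _) = mw i in p

    hi≰mm : ∀ i → ¬ hi i ≤ mm i
    hi≰mm i = let (_ , _ , _ , _ , p , _) = mw i in p

    hi≤lo∨jj : ∀ i → hi i ≤ (lo i ∨ jj i)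
    hi≤lo∨jj i = ⋖-join (lo⋖hi i) (jj≤hi i) (jj≰lo i)

    jj≰mm : ∀ i → ¬ jj i ≤ mm i
    jj≰mm i p = hi≰mm i (≤-trans (hi≤lo∨jj i) (∨-least (lo≤mm i) p))

    -- Different steps of the chain do not overlap, so `jj k` can enter only at its own. Injectivity
    -- of `jj` follows, and the count from extremality then makes its values exhaust the
    -- join-irreducibles.
    jj-index : ∀ {i k} → jj k ≤ hi i → ¬ jj k ≤ lo i → i ≡ k
    jj-index {i} {k} jk≤hi jk≰lo with separated i k
    ... | inj₁ hi≤lok = ⊥-elim (jj≰lo k (≤-trans jk≤hi hi≤lok))
    ... | inj₂ (inj₁ i≡k) = i≡k
    ... | inj₂ (inj₂ hik≤lo) = ⊥-elim (jk≰lo (≤-trans (jj≤hi k) hik≤lo))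

    mm-index : ∀ {i k} → lo i ≤ mm k → ¬ hi i ≤ mm k → i ≡ k
    mm-index {i} {k} lo≤mk hi≰mk with separated i k
    ... | inj₁ hi≤lok = ⊥-elim (hi≰mk (≤-trans hi≤lok (lo≤mm k)))
    ... | inj₂ (inj₁ i≡k) = i≡k
    ... | inj₂ (inj₂ hik≤lo) = ⊥-elim (hi≰mm k (≤-trans hik≤lo lo≤mk))

    jj-injective : ∀ {i k} → jj i ≡ jj k → i ≡ k
    jj-injective {i} e = jj-index (subst (_≤ hi i) e (jj≤hi i)) (jj≰lo i ∘ subst (_≤ lo i) (sym e))

    mm-injective : ∀ {i k} → mm i ≡ mm k → i ≡ k
    mm-injective {i} e = mm-index (subst (lo i ≤_) e (lo≤mm i)) (hi≰mm i ∘ subst (hi i ≤_) (sym e))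

    JI-jj : ∀ {j} → JI bot top j → ∃ λ i → jj i ≡ j
    JI-jj = exhaustive jj jj-JI jj-injective ji-card

    MI-mm : ∀ {m} → MI bot top m → ∃ λ i → mm i ≡ m
    MI-mm = exhaustive mm mm-MI mm-injective mi-card

    -- A minimal `p ≤ w ∧ hi i` not below `lo i` is join-irreducible, so it is some `jj k`; it
    -- enters the chain at step `i`, whence `k` is `i`.
    jj-least : ∀ {i w} → ¬ (w ∧ hi i) ≤ lo i → jj i ≤ w
    jj-least {i} {w} ≰lo with minimal-JI (minimum (w ∧ hi i)) (maximum (w ∧ hi i)) (minimum (lo i)) ≰lo
    ... | p , s , p-JI , p≤ , p≰lo , _ with JI-jj (s , p-JI)
    ...   | k , refl with jj-index (≤-trans p≤ (x∧y≤y w (hi i))) p≰lo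
    ...     | refl = ≤-trans p≤ (x∧y≤x w (hi i))

    mm-greatest : ∀ {i w} → ¬ hi i ≤ (w ∨ lo i) → w ≤ mm i
    mm-greatest {i} {w} hi≰
      with maximal-MI (minimum (w ∨ lo i)) (maximum (w ∨ lo i)) (maximum (hi i)) hi≰
    ... | q , t , q-MI , ≤q , hi≰q , _ with MI-mm (t , q-MI)
    ...   | k , refl with mm-index (≤-trans (y≤x∨y w (lo i)) ≤q) hi≰q
    ...     | refl = ≤-trans (x≤x∨y w (lo i)) ≤q

    frame : Frame L lo hi jj mm
    frame = record
      { lo≤hi = ⋖⇒≤ ∘ lo⋖hi
      ; separated = separated
      ; lo-modular = lm ∘ inject₁
      ; hi-modular = lm ∘ fsuc
      ; lo≤mm = lo≤mm
      ; jj≤hi = jj≤hi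
      ; jj≰mm = jj≰mm
      ; hi≤lo∨jj = hi≤lo∨jj
      ; mm∧hi≤lo = λ i → subst (_≤ lo i) (∧-comm (mm i) (hi i)) (⋖-meet (lo⋖hi i) (lo≤mm i) (hi≰mm i))
      ; jj-least = jj-least
      ; mm-greatest = mm-greatest
      ; cross-∨ = cross-∨
      ; cross-∧ = cross-∧
      }

    labelling : Labelling L bot top (allFin n) jj mm
    labelling = record
      { jj-JI = λ {i} _ → jj-JI i
      ; mm-MI = λ {i} _ → mm-MI i
      ; JI-jj = λ ji → let (i , e) = JI-jj ji in i , ∈-allFin i , e
      ; MI-mm = λ mi → let (i , e) = MI-mm mi in i , ∈-allFin i , e
      ; jj⇒mm = λ _ _ e → cong mm (jj-injective e)
      ; mm⇒jj = λ _ _ e → cong jj (mm-injective e)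
      ; jj≰mm = λ {i} _ → jj≰mm i
      ; label = λ _ _ → label
      }
      where
      -- Take the step `i` at which the meet of `z` with the chain stops being below `y`. It serves
      -- both bounds: `z ∧ hi i ≤ lo i` would bring `z ∧ hi i` below `z ∧ lo i`, and
      -- `hi i ≤ y ∨ lo i` would bring it below `y ∨ (lo i ∧ z)` by left modularity; both are below
      -- `y`.
      label : ∀ {y z} → y ⋖ z → ∃ λ i → i ∈ allFin n × jj i ≤ z × y ≤ mm i
      label {y} {z} y⋖z with cross-∧ (⋖⇒≰ y⋖z)
      ... | i , z∧hi≰y , z∧lo≤y = i , ∈-allFin i
        , jj-least (λ z∧hi≤lo → z∧hi≰y (≤-trans (∧-greatest (x∧y≤x z (hi i)) z∧hi≤lo) z∧lo≤y))
        , mm-greatest (λ hi≤y∨lo → z∧hi≰y (≤-trans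
            (∧-greatest (≤-trans (x∧y≤y z (hi i)) hi≤y∨lo) (x∧y≤x z (hi i)))
            (≤-trans (≤-reflexive (lm (inject₁ i) y z (⋖⇒≤ y⋖z)))
              (∨-least ≤-refl (subst (_≤ y) (∧-comm z (lo i)) z∧lo≤y)))))

    ordered : Ordered L (allFin n) jj mm
    ordered = record
      { rank = toℕ
      ; rank-injective = toℕ-injective
      ; rank-< = λ {i} {k} _ _ i<k → ≤-trans (jj≤hi i) (≤-trans (hi≤lo i<k) (lo≤mm k))
      }

    semidistrim : Semidistrim
    semidistrim = labelling⇒semidistrim labelling (inj₂ ordered)
      (FrameIndependence.downFree frame) (FrameIndependence.downFree (dual-frame frame))

-- The chain of extremality and the left modular chain may differ, but their lengths agree:
-- `chain-length≤` bounds the first by the second, `longest` the second by the first. The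
-- irreducibles can then be counted along the left modular chain.
trim⇒semidistrim : (L : FinLattice) → Notions.Trim L → Notions.Semidistrim L
trim⇒semidistrim L ((k , d , (_ , _ , d-cover) , longest , ji-card , mi-card) , n , c , mc , lm)
  with ℕP.≤-antisym (LeftModularChain.chain-length≤ L c mc lm d (proj₁ ∘ d-cover))
                    (longest n c (proj₁ ∘ proj₂ (proj₂ mc)))
... | refl = LeftModularChain.Extremality.semidistrim L c mc lm ji-card mi-card

theorem6p2 : (L : FinLattice)
    → (Notions.Semidistributive L → Notions.Semidistrim L)
    × (Notions.Trim L → Notions.Semidistrim L)
theorem6p2 L = SemidistributiveLabelling.semidistributive⇒semidistrim L , trim⇒semidistrim L
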